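{- If $n\geq 2$ and $k>2^{n-1}$, there is a computable coloring $f:[\mathbb{N}]^n\rightarrow\{1,\dots,k\}$ and a computable $\phi:\mathbb{N}\rightarrow\mathbb{N}$ with $w\rightarrow(\phi(w))^n_{k+1}$ for all $w$ and $\liminf_w\phi(w)=\infty$, such that no $\Sigma^0_n$ definable set is both packed for $\phi$ and semi-homogeneous for $f$.
   Context: $[X]^n$ is the set of $n$-element subsets of $X$. $w\rightarrow(m)^n_k$ means: for every $X\subseteq\mathbb{N}$ with $|X|=w$ and every $g:[X]^n\rightarrow\{1,\dots,k\}$ there is $H\subseteq X$ with $|H|=m$ on whose $n$-element subsets $g$ is constant. $A$ is packed for $\phi$ if $|A\cap\{1,\dots,w\}|\geq\phi(w)$ for infinitely many $w$. $A$ is semi-homogeneous for $f$ if $f$ takes at most $2^{n-1}$ values on $[A]^n$. -}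

module Defs where

open import Data.Nat using (ℕ; zero; suc; _+_; _*_; _∸_; _^_; _≤_; _<_)
open import Data.Fin using (Fin; toℕ)
open import Data.Vec using (Vec; []; _∷_; lookup; toList)
open import Data.Vec.Relation.Unary.All using (All)
open import Data.Vec.Membership.Propositional using (_∈_)
open import Data.List.Relation.Unary.Linked using (Linked)
open import Data.Product using (Σ; ∃; _×_)
open import Data.Sum using (_⊎_)
open import Data.Empty using (⊥)
open import Relation.Nullary using (¬_)
open import Relation.Binary.PropositionalEquality using (_≡_)
open import Function.Bundles using (_⇔_)

data Term (m : ℕ) : Set where
  var  : Fin m → Term m
  zer  : Term m
  succ : Term m → Term m
  _⊕_  : Term m → Term m → Term m
  _⊗_  : Term m → Term m → Term m

data Formula (m : ℕ) : Set where
  _≐_   : Term m → Term m → Formula m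
  _≺_   : Term m → Term m → Formula m
  neg   : Formula m → Formula m
  _∧'_  : Formula m → Formula m → Formula m
  _∨'_  : Formula m → Formula m → Formula m
  ex    : Formula (suc m) → Formula m
  all   : Formula (suc m) → Formula m
  bex   : Term m → Formula (suc m) → Formula m
  ball  : Term m → Formula (suc m) → Formula m

evalT : ∀ {m} → Term m → Vec ℕ m → ℕ
evalT (var i)  ρ = lookup ρ i
evalT zer      ρ = 0
evalT (succ t) ρ = suc (evalT t ρ)
evalT (s ⊕ t)  ρ = evalT s ρ + evalT t ρ
evalT (s ⊗ t)  ρ = evalT s ρ * evalT t ρ

Sat : ∀ {m} → Formula m → Vec ℕ m → Set
Sat (s ≐ t)    ρ = evalT s ρ ≡ evalT t ρ
Sat (s ≺ t)    ρ = evalT s ρ < evalT t ρ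
Sat (neg φ)    ρ = ¬ Sat φ ρ
Sat (φ ∧' ψ)   ρ = Sat φ ρ × Sat ψ ρ
Sat (φ ∨' ψ)   ρ = Sat φ ρ ⊎ Sat ψ ρ
Sat (ex φ)     ρ = Σ ℕ λ y → Sat φ (y ∷ ρ)
Sat (all φ)    ρ = (y : ℕ) → Sat φ (y ∷ ρ)
Sat (bex t φ)  ρ = Σ ℕ λ y → y < evalT t ρ × Sat φ (y ∷ ρ)
Sat (ball t φ) ρ = (y : ℕ) → y < evalT t ρ → Sat φ (y ∷ ρ)

data Bounded {m : ℕ} : Formula m → Set where
  b-eq   : ∀ {s t} → Bounded (s ≐ t)
  b-lt   : ∀ {s t} → Bounded (s ≺ t)
  b-neg  : ∀ {φ} → Bounded φ → Bounded (neg φ)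
  b-and  : ∀ {φ ψ} → Bounded φ → Bounded ψ → Bounded (φ ∧' ψ)
  b-or   : ∀ {φ ψ} → Bounded φ → Bounded ψ → Bounded (φ ∨' ψ)
  b-bex  : ∀ {t φ} → Bounded φ → Bounded (bex t φ)
  b-ball : ∀ {t φ} → Bounded φ → Bounded (ball t φ)

mutual
  data IsΣ : ℕ → ∀ {m} → Formula m → Set where
    σ-zero : ∀ {m} {φ : Formula m} → Bounded φ → IsΣ 0 φ
    σ-base : ∀ {k m} {φ : Formula m} → IsΠ k φ → IsΣ (suc k) φ
    σ-ex   : ∀ {k m} {φ : Formula (suc m)} → IsΣ (suc k) φ → IsΣ (suc k) (ex φ)

  data IsΠ : ℕ → ∀ {m} → Formula m → Set where
    π-zero : ∀ {m} {φ : Formula m} → Bounded φ → IsΠ 0 φ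
    π-base : ∀ {k m} {φ : Formula m} → IsΣ k φ → IsΠ (suc k) φ
    π-all  : ∀ {k m} {φ : Formula (suc m)} → IsΠ (suc k) φ → IsΠ (suc k) (all φ)

Defined : Formula 1 → ℕ → Set
Defined φ x = Sat φ (x ∷ [])

-- Computability (a function is computable iff its graph is Σ₁-definable)

ComputableFun : (ℕ → ℕ) → Set
ComputableFun φ = Σ (Formula 2) λ ψ → IsΣ 1 ψ ×
  ((w y : ℕ) → Sat ψ (y ∷ w ∷ []) ⇔ (φ w ≡ y))

-- Finite sets as strictly increasing vectors

Increasing : ∀ {m} → Vec ℕ m → Set
Increasing v = Linked _<_ (toList v)

-- A coloring of [ℕ]^n with colors Fin k (colors 1..k read as 0..k-1);
-- only its values on strictly increasing vectors (= n-element sets) matter.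
ComputableColoring : ∀ {n k} → (Vec ℕ n → Fin k) → Set
ComputableColoring {n} f = Σ (Formula (suc n)) λ ψ → IsΣ 1 ψ ×
  ((s : Vec ℕ n) → Increasing s → (c : ℕ) → Sat ψ (c ∷ s) ⇔ (toℕ (f s) ≡ c))

Arrow : ℕ → ℕ → ℕ → ℕ → Set
Arrow w m n c = (X : Vec ℕ w) → Increasing X → (g : Vec ℕ n → Fin c) →
  Σ (Vec ℕ m) λ H → Increasing H × All (_∈ X) H ×
    Σ (Fin c) λ col → (s : Vec ℕ n) → Increasing s → All (_∈ H) s → g s ≡ col

LiminfInfinite : (ℕ → ℕ) → Set
LiminfInfinite φ = (M : ℕ) → Σ ℕ λ N → (w : ℕ) → N ≤ w → M ≤ φ w

Packed : (ℕ → ℕ) → (ℕ → Set) → Set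
Packed φ A = (N : ℕ) → Σ ℕ λ w → N ≤ w ×
  Σ (Vec ℕ (φ w)) λ L → Increasing L × All (λ a → 1 ≤ a × a ≤ w × A a) L

SemiHomogeneous : ∀ {n k} → (Vec ℕ n → Fin k) → (ℕ → Set) → Set
SemiHomogeneous {n} {k} f A = Σ (Vec (Fin k) (2 ^ (n ∸ 1))) λ C →
  (s : Vec ℕ n) → Increasing s → All A s → f s ∈ C

{-# OPTIONS --safe #-}

-- Cut ℕ into blocks h = 0, 1, 2, … with h(w) so slow that φ(w) = n h(w) still satisfies the arrow relation. A packed set
-- has n elements in each of infinitely many blocks, so its n-sets s₁ < ⋯ < s_n show all 2 ^ (n ∸ 1) patterns of
-- coincidences "s_i and s_(i+1) lie in the same block". Colouring an n-set by its pattern, when there is a coincidence at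
-- all, leaves a semi-homogeneous packed set only one colour for the n-sets from n different blocks, which are 2-coloured.
--
-- That 2-colouring diagonalises against Σ_n sets as in Jockusch's theorem: x₂ < ⋯ < x_n serve as bounds for the
-- quantifiers after the first, and x₁ receives a prescribed colour if, seen with these bounds, it is among the first few
-- elements of the set with a given index.
--
-- Truth of a formula here is constructive, whereas the approximations converge to its negative translation, so that an
-- element of the approximated set need not be an element of the defined set. The colouring closes this gap: the colour Low
-- is also given to n-sets at which the approximations have not yet stabilised, and x₁ is a candidate only if it bounds the
-- witnesses of small statements. An infinite set without the colour Low then bounds such witnesses by its successive
-- elements; an infinite set with only Low consists of candidates, which are too sparse not to bound them. Either way the
-- levels below n ∸ 1 become decidable and Markov's principle holds for them, and the two readings agree.
--
-- Universal Σ₁ predicates and Σ₁ graphs come from certificates: finite sets of facts "program e maps x to y", closed under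
-- the clauses of evaluation and coded by the divisors 1 + (z + 1) m of a number c.

module Submission where

open import Data.Nat
open import Data.Nat.Properties
open import Data.Nat.Divisibility using (_∣_; divides; ∣-trans; ∣n⇒∣m*n; ∣m+n∣m⇒∣n; ∣1⇒≡1; m∣m*n; m≤n⇒m!∣n!)
open import Data.Nat.Coprimality using (Coprime; coprime-divisor)
open import Data.Nat.Tactic.RingSolver using (solve-∀)
open import Data.Fin using (Fin; toℕ; fromℕ<)
import Data.Fin as F
import Data.Fin.Properties as F
open import Data.Vec using (Vec; []; _∷_; lookup; toList)
open import Data.Vec.Relation.Unary.All as All using (All; []; _∷_)
open import Data.Vec.Membership.Propositional.Properties using (∈-toList⁻)
open import Data.Vec.Membership.Propositional using (_∈_)
import Data.Vec.Relation.Unary.Any as AnyV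
open import Data.Vec.Relation.Unary.Any.Properties using (lookup-index)
import Data.Vec as V
open import Data.Vec.Properties using (tabulate-∘; tabulate∘lookup; length-toList)
open import Data.List using (List; []; _∷_; _++_; length)
open import Data.List.Membership.Propositional using () renaming (_∈_ to _∈ˡ_)
open import Data.List.Membership.Propositional.Properties using (∈-++⁺ˡ; ∈-++⁺ʳ; ∈-++⁻)
open import Data.List.Relation.Unary.Any using (here; there)
open import Data.List.Relation.Unary.Linked using (Linked; []; [-]; _∷_)
open import Data.Product
open import Data.Sum
open import Data.Empty
open import Data.Unit using (⊤; tt)
open import Relation.Nullary using (¬_; Dec; yes; no; contradiction)
open import Relation.Binary.PropositionalEquality
open import Relation.Nullary.Decidable using (decidable-stable)
open import Relation.Binary.Definitions using (tri<; tri≈; tri>)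
open import Function.Base using (_∘_; id; case_of_)
open import Function.Bundles using (_⇔_; mk⇔)
open import Defs

-- Primitive recursive programs over Cantor pairing

abstract
  tri : ℕ → ℕ
  tri zero    = 0
  tri (suc s) = suc s + tri s

  pair : ℕ → ℕ → ℕ
  pair x y = tri (x + y) + x

  next : ℕ × ℕ → ℕ × ℕ
  next (x , zero)  = 0 , suc x
  next (x , suc y) = suc x , y

  unpair : ℕ → ℕ × ℕ
  unpair zero    = 0 , 0
  unpair (suc z) = next (unpair z)

  π₁ π₂ : ℕ → ℕ
  π₁ z = proj₁ (unpair z)
  π₂ z = proj₂ (unpair z)

  pair-row : ∀ x → pair 0 (suc x) ≡ suc (pair x 0)
  pair-row x = begin
    suc x + tri x + 0     ≡⟨ +-identityʳ _ ⟩
    suc x + tri x         ≡⟨ +-comm (suc x) (tri x) ⟩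
    tri x + suc x         ≡⟨ +-suc (tri x) x ⟩
    suc (tri x + x)       ≡⟨ cong (λ s → suc (tri s + x)) (sym (+-identityʳ x)) ⟩
    suc (pair x 0)        ∎
    where open ≡-Reasoning

  pair-diag : ∀ x y → pair (suc x) y ≡ suc (pair x (suc y))
  pair-diag x y rewrite +-suc x y = +-suc _ x

  pair-next : ∀ p → pair (proj₁ (next p)) (proj₂ (next p)) ≡ suc (pair (proj₁ p) (proj₂ p))
  pair-next (x , zero)  = pair-row x
  pair-next (x , suc y) = pair-diag x y

  pair-unpair : ∀ z → pair (π₁ z) (π₂ z) ≡ z
  pair-unpair zero    = refl
  pair-unpair (suc z) = trans (pair-next (unpair z)) (cong suc (pair-unpair z))

  unpair-pair : ∀ x y → unpair (pair x y) ≡ (x , y)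
  unpair-pair x y = go (x + y) x y refl
    where
    go : ∀ s x y → x + y ≡ s → unpair (pair x y) ≡ (x , y)
    go s       zero    zero    eq = refl
    go (suc s) zero    (suc y) eq =
      trans (cong unpair (pair-row y)) (cong next (go s y 0 (trans (+-identityʳ y) (suc-injective eq))))
    go s       (suc x) y       eq =
      trans (cong unpair (pair-diag x y)) (cong next (go s x (suc y) (trans (+-suc x y) eq)))

  π₁-pair : ∀ x y → π₁ (pair x y) ≡ x
  π₁-pair x y = cong proj₁ (unpair-pair x y)

  π₂-pair : ∀ x y → π₂ (pair x y) ≡ y
  π₂-pair x y = cong proj₂ (unpair-pair x y)

  fst≤pair : ∀ x y → x ≤ pair x y
  fst≤pair x y = m≤n+m x (tri (x + y))

  double-pair : ∀ x y → pair x y + pair x y ≡ (x + y) * suc (x + y) + (x + x)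
  double-pair x y = trans (shuffle (tri (x + y)) x) (cong (_+ (x + x)) (double-tri (x + y)))
    where
    shuffle : ∀ a b → a + b + (a + b) ≡ a + a + (b + b)
    shuffle = solve-∀
    step : ∀ s t → suc s + t + (suc s + t) ≡ suc s + suc s + (t + t)
    step = solve-∀
    step′ : ∀ s → suc s + suc s + s * suc s ≡ suc s * suc (suc s)
    step′ = solve-∀
    double-tri : ∀ s → tri s + tri s ≡ s * suc s
    double-tri zero    = refl
    double-tri (suc s) = trans (step s (tri s)) (trans (cong (suc s + suc s +_) (double-tri s)) (step′ s))

double-injective : ∀ {x y} → x + x ≡ y + y → x ≡ y
double-injective {zero}  {zero}  _  = refl
double-injective {suc x} {suc y} eq =
  cong suc (double-injective (suc-injective (trans (sym (+-suc x x)) (trans (suc-injective eq) (+-suc y y)))))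

data Prog : Set where
  pzero psuc pfst psnd : Prog
  ppair pcomp          : Prog → Prog → Prog
  piter                : Prog → Prog

iter : (ℕ → ℕ) → ℕ → ℕ → ℕ
iter f zero    x = x
iter f (suc n) x = f (iter f n x)

eval : Prog → ℕ → ℕ
eval pzero       z = 0
eval psuc        z = suc z
eval pfst        z = π₁ z
eval psnd        z = π₂ z
eval (ppair p q) z = pair (eval p z) (eval q z)
eval (pcomp p q) z = eval p (eval q z)
eval (piter p)   z = iter (eval p) (π₁ z) (π₂ z)

Comp : (ℕ → ℕ) → Set
Comp u = Σ Prog λ p → ∀ z → eval p z ≡ u z

comp-ext : ∀ {u w} → (∀ z → u z ≡ w z) → Comp u → Comp w
comp-ext e (p , q) = p , λ z → trans (q z) (e z)

comp-id : Comp (λ z → z)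
comp-id = ppair pfst psnd , pair-unpair

comp-const : ∀ k → Comp (λ _ → k)
comp-const zero    = pzero , λ _ → refl
comp-const (suc k) with comp-const k
... | p , e = pcomp psuc p , λ z → cong suc (e z)

comp-∘ : ∀ {u w} → Comp u → Comp w → Comp (λ z → u (w z))
comp-∘ {u} (p , e) (q , e′) = pcomp p q , λ z → trans (e _) (cong u (e′ z))

comp-suc : ∀ {u} → Comp u → Comp (λ z → suc (u z))
comp-suc c = comp-∘ (psuc , λ _ → refl) c

comp-π₁ : ∀ {u} → Comp u → Comp (λ z → π₁ (u z))
comp-π₁ c = comp-∘ (pfst , λ _ → refl) c

comp-π₂ : ∀ {u} → Comp u → Comp (λ z → π₂ (u z))
comp-π₂ c = comp-∘ (psnd , λ _ → refl) c

comp-pair : ∀ {u w} → Comp u → Comp w → Comp (λ z → pair (u z) (w z))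
comp-pair (p , e) (q , e′) = ppair p q , λ z → cong₂ pair (e z) (e′ z)

-- `piter` takes no parameters, so the state of the iteration carries `z` along in its first
-- component.
comp-iter : ∀ {G : ℕ → ℕ → ℕ} {n s : ℕ → ℕ} → Comp (λ w → G (π₁ w) (π₂ w)) → Comp n → Comp s →
            Comp (λ z → iter (G z) (n z) (s z))
comp-iter {G} {n} {s} cG cn cs = pcomp psnd (pcomp (piter (proj₁ cstep)) (proj₁ cinit)) , correct
  where
  step : ℕ → ℕ
  step w = pair (π₁ w) (G (π₁ w) (π₂ w))
  cstep : Comp step
  cstep = comp-pair (comp-π₁ comp-id) cG
  cinit : Comp (λ z → pair (n z) (pair z (s z)))
  cinit = comp-pair cn (comp-pair comp-id cs)
  run : ∀ z k → iter (eval (proj₁ cstep)) k (pair z (s z)) ≡ pair z (iter (G z) k (s z))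
  run z zero    = refl
  run z (suc k) rewrite run z k | proj₂ cstep (pair z (iter (G z) k (s z)))
    | π₁-pair z (iter (G z) k (s z)) | π₂-pair z (iter (G z) k (s z)) = refl
  correct : ∀ z → eval (pcomp psnd (pcomp (piter (proj₁ cstep)) (proj₁ cinit))) z ≡ iter (G z) (n z) (s z)
  correct z rewrite proj₂ cinit z | π₁-pair (n z) (pair z (s z)) | π₂-pair (n z) (pair z (s z))
    | run z (n z) = π₂-pair z _

natrec : (ℕ → ℕ → ℕ) → ℕ → ℕ → ℕ
natrec G s zero    = s
natrec G s (suc i) = G i (natrec G s i)

comp-natrec : ∀ {G : ℕ → ℕ → ℕ → ℕ} {n s : ℕ → ℕ} →
              Comp (λ w → G (π₁ w) (π₁ (π₂ w)) (π₂ (π₂ w))) → Comp n → Comp s →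
              Comp (λ z → natrec (G z) (s z) (n z))
comp-natrec {G} {n} {s} cG cn cs = comp-ext correct (comp-π₂ (comp-iter cstep cn (comp-pair (comp-const 0) cs)))
  where
  step : ℕ → ℕ → ℕ
  step z w = pair (suc (π₁ w)) (G z (π₁ w) (π₂ w))
  cstep : Comp (λ w → step (π₁ w) (π₂ w))
  cstep = comp-pair (comp-suc (comp-π₁ (comp-π₂ comp-id))) cG
  run : ∀ z k → iter (step z) k (pair 0 (s z)) ≡ pair k (natrec (G z) (s z) k)
  run z zero    = refl
  run z (suc k) rewrite run z k | π₁-pair k (natrec (G z) (s z) k) | π₂-pair k (natrec (G z) (s z) k) = refl
  correct : ∀ z → π₂ (iter (step z) (n z) (pair 0 (s z))) ≡ natrec (G z) (s z) (n z)
  correct z rewrite run z (n z) = π₂-pair (n z) _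

comp-+ : ∀ {u w} → Comp u → Comp w → Comp (λ z → u z + w z)
comp-+ {u} {w} cu cw = comp-ext (λ z → correct (u z) (w z)) (comp-iter (comp-suc (comp-π₂ comp-id)) cu cw)
  where
  correct : ∀ a b → iter suc a b ≡ a + b
  correct zero    b = refl
  correct (suc a) b = cong suc (correct a b)

comp-* : ∀ {u w} → Comp u → Comp w → Comp (λ z → u z * w z)
comp-* {u} {w} cu cw =
  comp-ext (λ z → correct z (u z)) (comp-iter (comp-+ (comp-∘ cw (comp-π₁ comp-id)) (comp-π₂ comp-id)) cu (comp-const 0))
  where
  correct : ∀ z a → iter (w z +_) a 0 ≡ a * w z
  correct z zero    = refl
  correct z (suc a) = cong (w z +_) (correct z a)

comp-pred : ∀ {u} → Comp u → Comp (λ z → pred (u z))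
comp-pred {u} cu = comp-ext (λ z → correct (u z))
  (comp-natrec {G = λ _ i _ → i} (comp-π₁ (comp-π₂ comp-id)) cu (comp-const 0))
  where
  correct : ∀ a → natrec (λ i _ → i) 0 a ≡ pred a
  correct zero    = refl
  correct (suc a) = refl

comp-∸ : ∀ {u w} → Comp u → Comp w → Comp (λ z → u z ∸ w z)
comp-∸ {u} {w} cu cw = comp-ext (λ z → correct (u z) (w z))
  (comp-iter (comp-pred (comp-π₂ comp-id)) cw cu)
  where
  correct : ∀ a b → iter pred b a ≡ a ∸ b
  correct a zero    = refl
  correct a (suc b) = trans (cong pred (correct a b)) (pred[m∸n]≡m∸[1+n] a b)

comp-2^ : ∀ {u} → Comp u → Comp (λ z → 2 ^ u z)
comp-2^ {u} cu = comp-ext (λ z → correct (u z))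
  (comp-iter (comp-* (comp-const 2) (comp-π₂ comp-id)) cu (comp-const 1))
  where
  correct : ∀ a → iter (2 *_) a 1 ≡ 2 ^ a
  correct zero    = refl
  correct (suc a) = cong (2 *_) (correct a)

-- Predicates with computable characteristic functions

record DecC (P : ℕ → Set) : Set where
  field
    χ    : ℕ → ℕ
    comp : Comp χ
    spec : ∀ z → P z × χ z ≡ 1 ⊎ ¬ P z × χ z ≡ 0
open DecC

dec : ∀ {P} → DecC P → ∀ z → Dec (P z)
dec d z with spec d z
... | inj₁ (p , _) = yes p
... | inj₂ (p , _) = no p

dec-map : ∀ {P Q : ℕ → Set} → (∀ z → P z → Q z) → (∀ z → Q z → P z) → DecC P → DecC Q
dec-map f g d .χ      = χ d
dec-map f g d .comp   = comp d
dec-map f g d .spec z with spec d z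
... | inj₁ (p , e) = inj₁ (f z p , e)
... | inj₂ (p , e) = inj₂ (p ∘ g z , e)

dec-∘ : ∀ {P u} → DecC P → Comp u → DecC (λ z → P (u z))
dec-∘ d c .χ z    = χ d _
dec-∘ d c .comp   = comp-∘ (comp d) c
dec-∘ d c .spec z = spec d _

dec-¬ : ∀ {P} → DecC P → DecC (λ z → ¬ P z)
dec-¬ d .χ z    = 1 ∸ χ d z
dec-¬ d .comp   = comp-∸ (comp-const 1) (comp d)
dec-¬ d .spec z with spec d z
... | inj₁ (p , e) = inj₂ ((λ n → n p) , cong (1 ∸_) e)
... | inj₂ (p , e) = inj₁ (p , cong (1 ∸_) e)

dec-× : ∀ {P Q} → DecC P → DecC Q → DecC (λ z → P z × Q z)
dec-× d d′ .χ z    = χ d z * χ d′ z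
dec-× d d′ .comp   = comp-* (comp d) (comp d′)
dec-× d d′ .spec z with spec d z | spec d′ z
... | inj₁ (p , e) | inj₁ (q , e′) = inj₁ ((p , q) , cong₂ _*_ e e′)
... | inj₁ (p , e) | inj₂ (q , e′) = inj₂ ((q ∘ proj₂) , cong₂ _*_ e e′)
... | inj₂ (p , e) | _             = inj₂ ((p ∘ proj₁) , cong (_* χ d′ z) e)

dec-⊎ : ∀ {P Q} → DecC P → DecC Q → DecC (λ z → P z ⊎ Q z)
dec-⊎ {P} {Q} d d′ = dec-map to (λ z → λ { (inj₁ p) (n , _) → n p ; (inj₂ q) (_ , n) → n q })
                             (dec-¬ (dec-× (dec-¬ d) (dec-¬ d′)))
  where
  to : ∀ z → ¬ (¬ P z × ¬ Q z) → P z ⊎ Q z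
  to z n with dec d z | dec d′ z
  ... | yes p | _     = inj₁ p
  ... | no _  | yes q = inj₂ q
  ... | no p  | no q  = contradiction (p , q) n

dec-→ : ∀ {P Q} → DecC P → DecC Q → DecC (λ z → P z → Q z)
dec-→ {P} {Q} d d′ = dec-map (λ z → λ { (inj₁ n) p → contradiction p n ; (inj₂ q) _ → q }) from
                             (dec-⊎ (dec-¬ d) d′)
  where
  from : ∀ z → (P z → Q z) → ¬ P z ⊎ Q z
  from z f with dec d z
  ... | yes p = inj₂ (f p)
  ... | no p  = inj₁ p

dec-⊤ : DecC (λ _ → ⊤)
dec-⊤ .χ _    = 1
dec-⊤ .comp   = comp-const 1
dec-⊤ .spec z = inj₁ (tt , refl)

dec-≤ : ∀ {u w} → Comp u → Comp w → DecC (λ z → u z ≤ w z)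
dec-≤ {u} {w} cu cw .χ z  = 1 ∸ (u z ∸ w z)
dec-≤ cu cw .comp         = comp-∸ (comp-const 1) (comp-∸ cu cw)
dec-≤ {u} {w} cu cw .spec z with u z ≤? w z
... | yes p = inj₁ (p , cong (1 ∸_) (m≤n⇒m∸n≡0 p))
... | no p  = inj₂ (p , m≤n⇒m∸n≡0 (m<n⇒0<n∸m (≰⇒> p)))

dec-< : ∀ {u w} → Comp u → Comp w → DecC (λ z → u z < w z)
dec-< cu cw = dec-≤ (comp-suc cu) cw

dec-≡ : ∀ {u w} → Comp u → Comp w → DecC (λ z → u z ≡ w z)
dec-≡ cu cw = dec-map (λ z (p , q) → ≤-antisym p q) (λ z e → ≤-reflexive e , ≤-reflexive (sym e))
                      (dec-× (dec-≤ cu cw) (dec-≤ cw cu))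

dec-∀< : ∀ {Q : ℕ → ℕ → Set} {n} → Comp n → DecC (λ w → Q (π₁ w) (π₂ w)) →
         DecC (λ z → ∀ a → a < n z → Q z a)
dec-∀< {Q} {n} cn d = result
  where
  G : ℕ → ℕ → ℕ → ℕ
  G z i acc = acc * χ d (pair z i)
  run : ∀ z k → (∀ a → a < k → Q z a) × natrec (G z) 1 k ≡ 1 ⊎ ¬ (∀ a → a < k → Q z a) × natrec (G z) 1 k ≡ 0
  run z zero = inj₁ ((λ _ ()) , refl)
  run z (suc k) with run z k
  ... | inj₂ (p , e) = inj₂ ((λ f → p λ a lt → f a (m<n⇒m<1+n lt)) , cong (_* χ d (pair z k)) e)
  ... | inj₁ (p , e) with spec d (pair z k)
  ... | inj₁ (q , e′) = inj₁ ((λ a lt → every a (m<1+n⇒m<n∨m≡n lt)) , cong₂ _*_ e e′)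
    where
    q′ : Q z k
    q′ = subst₂ Q (π₁-pair z k) (π₂-pair z k) q
    every : ∀ a → a < k ⊎ a ≡ k → Q z a
    every a (inj₁ lt)   = p a lt
    every a (inj₂ refl) = q′
  ... | inj₂ (q , e′) = inj₂ ((λ f → q (subst₂ Q (sym (π₁-pair z k)) (sym (π₂-pair z k)) (f k ≤-refl)))
                             , cong₂ _*_ e e′)
  result : DecC (λ z → ∀ a → a < n z → Q z a)
  result .χ z    = natrec (G z) 1 (n z)
  result .comp   = comp-natrec (comp-* (comp-π₂ (comp-π₂ comp-id))
    (comp-∘ (comp d) (comp-pair (comp-π₁ comp-id) (comp-π₁ (comp-π₂ comp-id))))) cn (comp-const 1)
  result .spec z = run z (n z)

search< : ∀ {P : ℕ → Set} → (∀ a → Dec (P a)) → ∀ k → (∃ λ a → a < k × P a) ⊎ (∀ a → a < k → ¬ P a)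
search< P? zero = inj₂ λ _ ()
search< {P} P? (suc k) with search< P? k
... | inj₁ (a , lt , p) = inj₁ (a , m<n⇒m<1+n lt , p)
... | inj₂ none with P? k
... | yes p = inj₁ (k , ≤-refl , p)
... | no ¬p = inj₂ λ a lt → case m<1+n⇒m<n∨m≡n lt of λ { (inj₁ l) → none a l ; (inj₂ refl) → ¬p }

dec-∃< : ∀ {Q : ℕ → ℕ → Set} {n} → Comp n → DecC (λ w → Q (π₁ w) (π₂ w)) →
         DecC (λ z → ∃ λ a → a < n z × Q z a)
dec-∃< {Q} {n} cn d = dec-map to (λ z (a , lt , q) f → f a lt q) (dec-¬ (dec-∀< {Q = λ z a → ¬ Q z a} cn (dec-¬ d)))
  where
  Q? : ∀ z a → Dec (Q z a)
  Q? z a with dec d (pair z a)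
  ... | yes q = yes (subst₂ Q (π₁-pair z a) (π₂-pair z a) q)
  ... | no q  = no λ q′ → q (subst₂ Q (sym (π₁-pair z a)) (sym (π₂-pair z a)) q′)
  to : ∀ z → ¬ (∀ a → a < n z → ¬ Q z a) → ∃ λ a → a < n z × Q z a
  to z f with search< (Q? z) (n z)
  ... | inj₁ r    = r
  ... | inj₂ none = contradiction none f

-- Σ₁ definability of program evaluation

record CompV {m} (g : ℕ → Vec ℕ m) : Set where
  constructor mkV
  field entry : ∀ i → Comp (λ w → lookup (g w) i)
open CompV

compV-[] : CompV (λ _ → [])
compV-[] .entry ()

compV-∷ : ∀ {m} {u : ℕ → ℕ} {g : ℕ → Vec ℕ m} → Comp u → CompV g → CompV (λ w → u w ∷ g w)
compV-∷ cu cg .entry F.zero    = cu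
compV-∷ cu cg .entry (F.suc i) = entry cg i

compV-∘ : ∀ {m} {g : ℕ → Vec ℕ m} {u : ℕ → ℕ} → CompV g → Comp u → CompV (λ w → g (u w))
compV-∘ cg cu .entry i = comp-∘ (entry cg i) cu

compV-const : ∀ {m} (ρ : Vec ℕ m) → CompV (λ _ → ρ)
compV-const ρ .entry i = comp-const (lookup ρ i)

comp-term : ∀ {m} (t : Term m) {g : ℕ → Vec ℕ m} → CompV g → Comp (λ w → evalT t (g w))
comp-term (var i)  cg = entry cg i
comp-term zer      cg = comp-const 0
comp-term (succ t) cg = comp-suc (comp-term t cg)
comp-term (s ⊕ t)  cg = comp-+ (comp-term s cg) (comp-term t cg)
comp-term (s ⊗ t)  cg = comp-* (comp-term s cg) (comp-term t cg)

dec-bounded : ∀ {m} {φ : Formula m} → Bounded φ → {g : ℕ → Vec ℕ m} → CompV g → DecC (λ w → Sat φ (g w))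
dec-bounded (b-eq {s} {t}) cg = dec-≡ (comp-term s cg) (comp-term t cg)
dec-bounded (b-lt {s} {t}) cg = dec-< (comp-term s cg) (comp-term t cg)
dec-bounded (b-neg b)      cg = dec-¬ (dec-bounded b cg)
dec-bounded (b-and b b′)   cg = dec-× (dec-bounded b cg) (dec-bounded b′ cg)
dec-bounded (b-or b b′)    cg = dec-⊎ (dec-bounded b cg) (dec-bounded b′ cg)
dec-bounded (b-bex {t} {φ} b) {g} cg =
  dec-∃< {Q = λ w y → Sat φ (y ∷ g w)} (comp-term t cg)
    (dec-bounded b (compV-∷ (comp-π₂ comp-id) (compV-∘ cg (comp-π₁ comp-id))))
dec-bounded (b-ball {t} {φ} b) {g} cg =
  dec-∀< {Q = λ w y → Sat φ (y ∷ g w)} (comp-term t cg)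
    (dec-bounded b (compV-∷ (comp-π₂ comp-id) (compV-∘ cg (comp-π₁ comp-id))))

bounded? : ∀ {m} {φ : Formula m} → Bounded φ → ∀ ρ → Dec (Sat φ ρ)
bounded? b ρ = dec (dec-bounded b (compV-const ρ)) 0

-- Unlike pair, this injection is a term of the language; it codes programs and facts, where no decoding is needed.
abstract
  sq : ℕ → ℕ → ℕ
  sq x y = (x + y) * (x + y) + x

  sq-def : ∀ x y → sq x y ≡ (x + y) * (x + y) + x
  sq-def x y = refl

  -- As `x ≤ x + y`, the value lies between the square of `x + y` and the next square. It thus
  -- determines `x + y`, and then `x`.
  sq-injective : ∀ {x y x′ y′} → sq x y ≡ sq x′ y′ → x ≡ x′ × y ≡ y′
  sq-injective {x} {y} {x′} {y′} eq = x≡x′ , +-cancelˡ-≡ x y y′ (trans s≡s′ (cong (_+ y′) (sym x≡x′)))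
    where
    expand : ∀ s → suc (s * s + s) + s ≡ suc s * suc s
    expand = solve-∀
    below : ∀ {x y x′ y′} → x + y < x′ + y′ → sq x y < sq x′ y′
    below {x} {y} {x′} {y′} lt = begin
      suc (sq x y)                            ≤⟨ s≤s (+-monoʳ-≤ ((x + y) * (x + y)) (m≤m+n x y)) ⟩
      suc ((x + y) * (x + y) + (x + y))       ≤⟨ m≤m+n _ (x + y) ⟩
      suc ((x + y) * (x + y) + (x + y)) + (x + y) ≡⟨ expand (x + y) ⟩
      suc (x + y) * suc (x + y)               ≤⟨ *-mono-≤ lt lt ⟩
      (x′ + y′) * (x′ + y′)                   ≤⟨ m≤m+n _ x′ ⟩
      sq x′ y′                                ∎
      where open ≤-Reasoning
    s≡s′ : x + y ≡ x′ + y′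
    s≡s′ with <-cmp (x + y) (x′ + y′)
    ... | tri< lt _ _ = contradiction eq (<⇒≢ (below {x} {y} {x′} {y′} lt))
    ... | tri≈ _ e _  = e
    ... | tri> _ _ gt = contradiction (sym eq) (<⇒≢ (below {x′} {y′} {x} {y} gt))
    x≡x′ : x ≡ x′
    x≡x′ = +-cancelˡ-≡ ((x + y) * (x + y)) x x′ (trans eq (cong (λ s → s * s + x′) (sym s≡s′)))

code : Prog → ℕ
code pzero       = sq 0 0
code psuc        = sq 1 0
code pfst        = sq 2 0
code psnd        = sq 3 0
code (ppair p q) = sq 4 (sq (code p) (code q))
code (pcomp p q) = sq 5 (sq (code p) (code q))
code (piter p)   = sq 6 (code p)

fact : ℕ → ℕ → ℕ → ℕ
fact e x y = sq e (sq x y)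

sqT : ∀ {k} → Term k → Term k → Term k
sqT s t = ((s ⊕ t) ⊗ (s ⊕ t)) ⊕ s

factT : ∀ {k} → Term k → Term k → Term k → Term k
factT e x y = sqT e (sqT x y)

#_ : ∀ {k} → ℕ → Term k
# zero  = zer
# suc n = succ (# n)

wk : ∀ {k} → Term k → Term (suc k)
wk (var i)  = var (F.suc i)
wk zer      = zer
wk (succ t) = succ (wk t)
wk (s ⊕ t)  = wk s ⊕ wk t
wk (s ⊗ t)  = wk s ⊗ wk t

-- t ∈ S, where S = { t < b : 1 + (t + 1) m divides c }.
inF : ∀ {k} → Term k → Term k → Term k → Term k → Formula k
inF c m b t = (t ≺ b) ∧' bex (succ c) ((var F.zero ⊗ succ (succ (wk t) ⊗ wk m)) ≐ wk c)

-- Twice a Cantor pair is a polynomial, which spares the term language a division by 2.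
pairF : ∀ {k} → Term k → Term k → Term k → Formula k
pairF z x y = (z ⊕ z) ≐ (((x ⊕ y) ⊗ succ (x ⊕ y)) ⊕ (x ⊕ x))

v0 : ∀ {k} → Term (1 + k)
v0 = var F.zero
v1 : ∀ {k} → Term (2 + k)
v1 = wk v0
v2 : ∀ {k} → Term (3 + k)
v2 = wk v1
v3 : ∀ {k} → Term (4 + k)
v3 = wk v2
v4 : ∀ {k} → Term (5 + k)
v4 = wk v3
v5 : ∀ {k} → Term (6 + k)
v5 = wk v4
v6 : ∀ {k} → Term (7 + k)
v6 = wk v5
v7 : ∀ {k} → Term (8 + k)
v7 = wk v6
v8 : ∀ {k} → Term (9 + k)
v8 = wk v7
v9 : ∀ {k} → Term (10 + k)
v9 = wk v8
v10 : ∀ {k} → Term (11 + k)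
v10 = wk v9
v11 : ∀ {k} → Term (12 + k)
v11 = wk v10

-- The free variables are y, x, e, z, c, m, b: the fact z = (e, x, y) follows from members of S by a clause of eval.
ruleF : ∀ {k} → Formula (7 + k)
ruleF =
  ((v2 ≐ sqT (# 0) (# 0)) ∧' (v0 ≐ zer)) ∨'
  (((v2 ≐ sqT (# 1) (# 0)) ∧' (v0 ≐ succ v1)) ∨'
  (((v2 ≐ sqT (# 2) (# 0)) ∧' bex v6 (pairF v2 v1 v0)) ∨'
  (((v2 ≐ sqT (# 3) (# 0)) ∧' bex v6 (pairF v2 v0 v1)) ∨'
  (bex v6 (bex v7 (bex v8 (bex v9
    ((v6 ≐ sqT (# 4) (sqT v3 v2)) ∧' (pairF v4 v1 v0 ∧'
     (inF v8 v9 v10 (factT v3 v5 v1) ∧' inF v8 v9 v10 (factT v2 v5 v0))))))) ∨'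
  (bex v6 (bex v7 (bex v8
    ((v5 ≐ sqT (# 5) (sqT v2 v1)) ∧'
     (inF v7 v8 v9 (factT v1 v4 v0) ∧' inF v7 v8 v9 (factT v2 v0 v3))))) ∨'
  (bex v6 ((v3 ≐ sqT (# 6) v0) ∧' pairF v2 (# 0) v1) ∨'
   bex v6 (bex v7 (bex v8 (bex v9 (bex v10
    ((v7 ≐ sqT (# 6) v4) ∧' (pairF v6 (succ v3) v2 ∧' (pairF v1 v3 v2 ∧'
     (inF v9 v10 v11 (factT v7 v1 v0) ∧' inF v9 v10 v11 (factT v4 v0 v5)))))))))))))))

justF : ∀ {k} → Formula (4 + k)
justF = bex v3 (bex v4 (bex v5 ((v3 ≐ factT v2 v1 v0) ∧' ruleF)))

-- The free variables are c, m, b, z.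
certF : ∀ {k} → Formula (4 + k)
certF = inF v0 v1 v2 v3 ∧' ball v2 (neg (inF v1 v2 v3 v0) ∨' justF)

inF-bounded : ∀ {k} {c m b t : Term k} → Bounded (inF c m b t)
inF-bounded = b-and b-lt (b-bex b-eq)

certF-bounded : ∀ {k} → Bounded (certF {k})
certF-bounded = b-and inF-bounded (b-ball (b-or (b-neg inF-bounded) (b-bex (b-bex (b-bex (b-and b-eq
  (b-or (b-and b-eq b-eq)
  (b-or (b-and b-eq b-eq)
  (b-or (b-and b-eq (b-bex b-eq))
  (b-or (b-and b-eq (b-bex b-eq))
  (b-or (b-bex (b-bex (b-bex (b-bex (b-and b-eq (b-and b-eq (b-and inF-bounded inF-bounded)))))))
  (b-or (b-bex (b-bex (b-bex (b-and b-eq (b-and inF-bounded inF-bounded)))))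
  (b-or (b-bex (b-and b-eq b-eq))
        (b-bex (b-bex (b-bex (b-bex (b-bex
          (b-and b-eq (b-and b-eq (b-and b-eq (b-and inF-bounded inF-bounded))))))))))))))))))))))

-- Soundness of certificates

In : ℕ → ℕ → ℕ → ℕ → Set
In c m b t = t < b × ∃ λ q → q < suc c × q * suc (suc t * m) ≡ c

Just : ℕ → ℕ → ℕ → ℕ → Set
Just c m b z = Sat justF (z ∷ c ∷ m ∷ b ∷ [])

pair-eq : ∀ {z x y} → z + z ≡ (x + y) * suc (x + y) + (x + x) → z ≡ pair x y
pair-eq {z} {x} {y} e = double-injective (trans e (sym (double-pair x y)))

pair-eq⁻¹ : ∀ {z x y} → z ≡ pair x y → z + z ≡ (x + y) * suc (x + y) + (x + x)
pair-eq⁻¹ refl = double-pair _ _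

-- The content of `ruleF` with unbounded witnesses and an arbitrary set `I` of facts: soundness does
-- not depend on how the set is coded.
RuleAt : (ℕ → Set) → ℕ → ℕ → ℕ → ℕ → Set
RuleAt I 0 d x y = y ≡ 0
RuleAt I 1 d x y = y ≡ suc x
RuleAt I 2 d x y = ∃ λ b → x ≡ pair y b
RuleAt I 3 d x y = ∃ λ b → x ≡ pair b y
RuleAt I 4 d x y = ∃₂ λ a b → d ≡ sq a b × ∃₂ λ u v → y ≡ pair u v × I (fact a x u) × I (fact b x v)
RuleAt I 5 d x y = ∃₂ λ a b → d ≡ sq a b × ∃ λ u → I (fact b x u) × I (fact a u y)
RuleAt I 6 d x y = x ≡ pair 0 y ⊎
  ∃₂ λ n w → x ≡ pair (suc n) w × ∃ λ u → I (fact (sq 6 d) (pair n w) u) × I (fact d u y)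
RuleAt I _ d x y = ⊥

fact-def : ∀ e x y → fact e x y ≡ (e + ((x + y) * (x + y) + x)) * (e + ((x + y) * (x + y) + x)) + e
fact-def e x y rewrite sq-def e (sq x y) | sq-def x y = refl

pair-sq : ∀ t f g → (t + ((f + g) * (f + g) + f)) * (t + ((f + g) * (f + g) + f)) + t ≡ sq t (sq f g)
pair-sq t f g = sym (fact-def t f g)

Rule : (ℕ → Set) → ℕ → ℕ → ℕ → Set
Rule I e x y = ∃₂ λ t d → e ≡ sq t d × RuleAt I t d x y

in-fact : ∀ {c m b} e x y → Sat (inF v3 v4 v5 (factT v0 v1 v2)) (e ∷ x ∷ y ∷ c ∷ m ∷ b ∷ []) → In c m b (fact e x y)
in-fact {c} {m} {b} e x y = subst (In c m b) (sym (fact-def e x y))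

Just⇒Rule : ∀ {c m b e x y} → Just c m b (fact e x y) → Rule (In c m b) e x y
Just⇒Rule {c} {m} {b} {e} {x} {y} (e′ , _ , x′ , _ , y′ , _ , eq , r)
  with sq-injective {e} {_} {e′} (trans eq (sym (fact-def e′ x′ y′)))
... | refl , eq′ with sq-injective {x} {y} {x′} {y′} eq′
... | refl , refl = rule r
  where
  rule : Sat ruleF (y ∷ x ∷ e ∷ fact e x y ∷ c ∷ m ∷ b ∷ []) → Rule (In c m b) e x y
  rule (inj₁ (p , q)) = 0 , 0 , trans p (sym (sq-def 0 0)) , q
  rule (inj₂ (inj₁ (p , q))) = 1 , 0 , trans p (sym (sq-def 1 0)) , q
  rule (inj₂ (inj₂ (inj₁ (p , u , _ , q)))) = 2 , 0 , trans p (sym (sq-def 2 0)) , u , pair-eq q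
  rule (inj₂ (inj₂ (inj₂ (inj₁ (p , u , _ , q))))) = 3 , 0 , trans p (sym (sq-def 3 0)) , u , pair-eq q
  rule (inj₂ (inj₂ (inj₂ (inj₂ (inj₁ (f , _ , g , _ , u , _ , v , _ , p , q , i , j)))))) =
    4 , sq f g , trans p (pair-sq 4 f g) , f , g , refl , u , v , pair-eq q , in-fact f x u i , in-fact g x v j
  rule (inj₂ (inj₂ (inj₂ (inj₂ (inj₂ (inj₁ (f , _ , g , _ , u , _ , p , i , j))))))) =
    5 , sq f g , trans p (pair-sq 5 f g) , f , g , refl , u , in-fact g x u i , in-fact f u y j
  rule (inj₂ (inj₂ (inj₂ (inj₂ (inj₂ (inj₂ (inj₁ (f , _ , p , q)))))))) =
    6 , f , trans p (sym (sq-def 6 f)) , inj₁ (pair-eq q)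
  rule (inj₂ (inj₂ (inj₂ (inj₂ (inj₂ (inj₂ (inj₂ (f , _ , n , _ , w , _ , x′ , _ , u , _ , p , q , r , i , j)))))))) =
    6 , f , e≡ , inj₂ (n , w , pair-eq q , u
      , subst (In c m b) (cong₂ (λ e x → fact e x u) e≡ (pair-eq {x′} r)) (in-fact e x′ u i) , in-fact f u y j)
    where
    e≡ : e ≡ sq 6 f
    e≡ = trans p (sym (sq-def 6 f))

RuleFor : (ℕ → Set) → Prog → ℕ → ℕ → Set
RuleFor I pzero       x y = RuleAt I 0 0 x y
RuleFor I psuc        x y = RuleAt I 1 0 x y
RuleFor I pfst        x y = RuleAt I 2 0 x y
RuleFor I psnd        x y = RuleAt I 3 0 x y
RuleFor I (ppair p q) x y = RuleAt I 4 (sq (code p) (code q)) x y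
RuleFor I (pcomp p q) x y = RuleAt I 5 (sq (code p) (code q)) x y
RuleFor I (piter p)   x y = RuleAt I 6 (code p) x y

-- Distinct constructors have distinct tags, so injectivity of `sq` leaves a coded program only the
-- clause of its own constructor.
rule-for : ∀ {I} p {x y} → Rule I (code p) x y → RuleFor I p x y
rule-for p (t , d , eq , r) with p
... | pzero with refl , refl ← sq-injective {0} {0} {t} {d} eq = r
... | psuc with refl , refl ← sq-injective {1} {0} {t} {d} eq = r
... | pfst with refl , refl ← sq-injective {2} {0} {t} {d} eq = r
... | psnd with refl , refl ← sq-injective {3} {0} {t} {d} eq = r
... | ppair f g with refl , refl ← sq-injective {4} {sq (code f) (code g)} {t} {d} eq = r
... | pcomp f g with refl , refl ← sq-injective {5} {sq (code f) (code g)} {t} {d} eq = r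
... | piter f with refl , refl ← sq-injective {6} {code f} {t} {d} eq = r

module Soundness (I : ℕ → Set) (justified : ∀ e x y → I (fact e x y) → Rule I e x y) where

  -- Circular support among the facts does no harm: every clause appeals to facts about subprograms
  -- or with a smaller iteration count, and the induction runs over these.
  sound : ∀ p {x y} → I (fact (code p) x y) → y ≡ eval p x
  sound-iter : ∀ p → (∀ {x y} → I (fact (code p) x y) → y ≡ eval p x) →
               ∀ n w {y} → I (fact (sq 6 (code p)) (pair n w) y) → y ≡ iter (eval p) n w

  rule : ∀ p {x y} → I (fact (code p) x y) → RuleFor (I) p x y
  rule p i = rule-for p (justified _ _ _ i)

  sound pzero       i = rule pzero i
  sound psuc        i = rule psuc i
  sound pfst        i with d , refl ← rule pfst i = sym (π₁-pair _ d)
  sound psnd        i with d , refl ← rule psnd i = sym (π₂-pair d _)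
  sound (ppair p q) {x} i with f , g , eq , u , v , refl , i₁ , i₂ ← rule (ppair p q) i
    with refl , refl ← sq-injective {code p} {code q} {f} {g} eq =
    cong₂ pair (sound p i₁) (sound q i₂)
  sound (pcomp p q) {x} i with f , g , eq , u , i₁ , i₂ ← rule (pcomp p q) i
    with refl , refl ← sq-injective {code p} {code q} {f} {g} eq =
    trans (sound p i₂) (cong (eval p) (sound q i₁))
  sound (piter p) {x} {y} i = sound-iter p (sound p) (π₁ x) (π₂ x)
    (subst (λ x → I (fact (sq 6 (code p)) x y)) (sym (pair-unpair x)) i)

  sound-iter p s n w {y} i with rule (piter p) i
  sound-iter p s n w i | inj₁ eq with refl ← trans (sym (π₁-pair n w)) (trans (cong π₁ eq) (π₁-pair 0 _)) =
    trans (sym (π₂-pair 0 _)) (trans (cong π₂ (sym eq)) (π₂-pair 0 w))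
  sound-iter p s n w i | inj₂ (n′ , w′ , eq , u , i₁ , i₂)
    with refl ← trans (sym (π₁-pair n w)) (trans (cong π₁ eq) (π₁-pair (suc n′) w′))
       | refl ← trans (sym (π₂-pair n w)) (trans (cong π₂ eq) (π₂-pair (suc n′) w′)) =
    trans (s i₂) (cong (eval p) (sound-iter p s n′ w i₁))

-- Finite sets coded by divisors

modulus : ℕ → ℕ → ℕ
modulus m z = suc (suc z * m)

setCode : ℕ → List ℕ → ℕ
setCode m []      = 1
setCode m (z ∷ F) = modulus m z * setCode m F

member⇒∣ : ∀ m {z F} → z ∈ˡ F → modulus m z ∣ setCode m F
member⇒∣ m (here refl) = m∣m*n _
member⇒∣ m {F = y ∷ _} (there i) = ∣n⇒∣m*n (modulus m y) (member⇒∣ m i)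

∣-factorial : ∀ {j b} → .{{NonZero j}} → j ≤ b → j ∣ b !
∣-factorial {suc j} le = ∣-trans (m∣m*n (j !)) (m≤n⇒m!∣n! le)

modulus-coprime-factor : ∀ {f z i} → i ∣ f → i ∣ modulus f z → i ∣ 1
modulus-coprime-factor {f} {z} {i} i∣f i∣m = ∣m+n∣m⇒∣n (subst (i ∣_) (+-comm 1 (suc z * f)) i∣m) (∣n⇒∣m*n (suc z) i∣f)

-- A common divisor `d` divides `b ! * (z′ ∸ z)`. It is coprime to `b !`, hence divides `z′ ∸ z`,
-- which is at most `b` and so divides `b !`; being coprime to `b !` as well, `d` is 1.
modulus-coprime : ∀ {b z z′} → z < z′ → z′ < b → Coprime (modulus (b !) z) (modulus (b !) z′)
modulus-coprime {b} {z} {z′} lt lt′ {d} (d∣z , d∣z′) = ∣1⇒≡1 (modulus-coprime-factor {b !} {z} d∣b! d∣z)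
  where
  split : modulus (b !) z + b ! * (z′ ∸ z) ≡ modulus (b !) z′
  split = begin
    modulus (b !) z + b ! * (z′ ∸ z)       ≡⟨ rearrange (b !) z (z′ ∸ z) ⟩
    modulus (b !) (z + (z′ ∸ z))           ≡⟨ cong (modulus (b !)) (m+[n∸m]≡n (<⇒≤ lt)) ⟩
    modulus (b !) z′                       ∎
    where
    open ≡-Reasoning
    rearrange : ∀ f z k → suc (suc z * f) + f * k ≡ suc (suc (z + k) * f)
    rearrange = solve-∀
  d∣diff : d ∣ b ! * (z′ ∸ z)
  d∣diff = ∣m+n∣m⇒∣n (subst (d ∣_) (sym split) d∣z′) d∣z
  d∣b! : d ∣ b !
  d∣b! = ∣-trans
    (coprime-divisor {n = b !}
      (λ {i} (i∣d , i∣b!) → ∣1⇒≡1 (modulus-coprime-factor {b !} {z} {i} i∣b! (∣-trans i∣d d∣z))) d∣diff)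
    (∣-factorial {{>-nonZero (m<n⇒0<n∸m lt)}} (≤-trans (m∸n≤m z′ z) (<⇒≤ lt′)))

-- Factors coprime to that of `z` are cancelled one by one until the factor of `z` itself is met.
-- The empty product 1 has no divisor above 1.
∣⇒member : ∀ {b z F} → z < b → (∀ {y} → y ∈ˡ F → y < b) → modulus (b !) z ∣ setCode (b !) F → z ∈ˡ F
∣⇒member {b} {z} {[]} lt F< d = contradiction (suc-injective (∣1⇒≡1 d)) (≢-nonZero⁻¹ (suc z * b !) {{m*n≢0 (suc z) (b !) {{_}} {{b !≢0}}}})
∣⇒member {b} {z} {y ∷ F} lt F< d with <-cmp z y
... | tri< z<y _ _  = there (∣⇒member lt (F< ∘ there) (coprime-divisor (modulus-coprime z<y (F< (here refl))) d))
... | tri≈ _ refl _ = here refl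
... | tri> _ _ y<z  = there (∣⇒member lt (F< ∘ there) (coprime-divisor (λ (p , q) → modulus-coprime y<z lt (q , p)) d))

module _ {b : ℕ} (F : List ℕ) (F< : ∀ {y} → y ∈ˡ F → y < b) where

  member⇒In : ∀ {z} → z ∈ˡ F → In (setCode (b !) F) (b !) b z
  member⇒In {z} i with member⇒∣ (b !) i
  ... | divides q eq = F< i , q , s≤s (≤-trans (m≤m*n q (modulus (b !) z)) (≤-reflexive (sym eq))) , sym eq

  In⇒member : ∀ {z} → In (setCode (b !) F) (b !) b z → z ∈ˡ F
  In⇒member (lt , q , _ , eq) = ∣⇒member lt F< (divides q (sym eq))

-- The second component bounds the witnesses of the bounded quantifiers in justF.
Justified : List ℕ → List ℕ → Set
Justified F G = ∃ λ b₀ → ∀ c m b → b₀ ≤ b → (∀ {z} → z ∈ˡ F → In c m b z) → ∀ {z} → z ∈ˡ G → Just c m b z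

justified-++ : ∀ {F G} → Justified F F → Justified G G → Justified (F ++ G) (F ++ G)
justified-++ {F} {G} (b₁ , f) (b₂ , g) = b₁ ⊔ b₂ , λ c m b le i → λ {z} z∈ → case ∈-++⁻ F z∈ of λ where
  (inj₁ p) → f c m b (≤-trans (m≤m⊔n b₁ b₂) le) (i ∘ ∈-++⁺ˡ) p
  (inj₂ q) → g c m b (≤-trans (m≤n⊔m b₁ b₂) le) (i ∘ ∈-++⁺ʳ F) q

justified-∷ : ∀ {z F} → Justified F (z ∷ []) → Justified F F → Justified (z ∷ F) (z ∷ F)
justified-∷ (b₁ , f) (b₂ , g) = b₁ ⊔ b₂ , λ c m b le i → λ where
  (here refl) → f c m b (≤-trans (m≤m⊔n b₁ b₂) le) (i ∘ there) (here refl)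
  (there q)   → g c m b (≤-trans (m≤n⊔m b₁ b₂) le) (i ∘ there) q

bound : List ℕ → ℕ
bound []       = 0
bound (x ∷ xs) = suc x ⊔ bound xs

<-bound : ∀ {x xs} → x ∈ˡ xs → x < bound xs
<-bound {xs = y ∷ xs} (here refl) = m≤m⊔n (suc y) (bound xs)
<-bound {xs = y ∷ xs} (there i)   = ≤-trans (<-bound i) (m≤n⊔m (suc y) (bound xs))

-- `ws` lists the witnesses that a clause of `ruleF` asks for; a bound `b` above them and above the
-- parts of the fact satisfies all bounded quantifiers.
justified-fact : ∀ {F} e x y (ws : List ℕ) →
  (∀ c m b → (∀ {w} → w ∈ˡ (e ∷ x ∷ y ∷ ws) → w < b) → (∀ {z} → z ∈ˡ F → In c m b z) →
    Sat ruleF (y ∷ x ∷ e ∷ fact e x y ∷ c ∷ m ∷ b ∷ [])) →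
  Justified F (fact e x y ∷ [])
justified-fact e x y ws r = bound (e ∷ x ∷ y ∷ ws) , λ c m b le i → λ where
  (here refl) → let lt = λ {w} (p : w ∈ˡ (e ∷ x ∷ y ∷ ws)) → ≤-trans (<-bound p) le in
    e , lt (here refl) , x , lt (there (here refl)) , y , lt (there (there (here refl))) , fact-def e x y , r c m b lt i

justified-[] : Justified [] []
justified-[] = 0 , λ c m b le i ()

fact-in : ∀ {c m b} e x y → In c m b (fact e x y) → Sat (inF v3 v4 v5 (factT v0 v1 v2)) (e ∷ x ∷ y ∷ c ∷ m ∷ b ∷ [])
fact-in {c} {m} {b} e x y = subst (In c m b) (fact-def e x y)

-- The list follows the evaluation of the program, each fact standing in front of those that support
-- it.
derivation : ∀ p x → ∃ λ F → fact (code p) x (eval p x) ∈ˡ F × Justified F F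

derivation-iter : ∀ p → (∀ x → ∃ λ F → fact (code p) x (eval p x) ∈ˡ F × Justified F F) → ∀ n w →
  ∃ λ F → fact (code (piter p)) (pair n w) (iter (eval p) n w) ∈ˡ F × Justified F F
derivation-iter p d zero w = fact (code (piter p)) (pair 0 w) w ∷ [] , here refl ,
  justified-∷ (justified-fact _ _ _ (code p ∷ []) λ c m b lt i →
    inj₂ (inj₂ (inj₂ (inj₂ (inj₂ (inj₂ (inj₁
      (code p , lt (there (there (there (here refl)))) , sq-def 6 (code p) , pair-eq⁻¹ refl)))))))) justified-[]
derivation-iter p d (suc n) w with derivation-iter p d n w | d (iter (eval p) n w)
... | F , F∋ , jF | G , G∋ , jG = _ ∷ F ++ G , here refl ,
  justified-∷ (justified-fact _ _ _ (code p ∷ n ∷ w ∷ pair n w ∷ iter (eval p) n w ∷ []) λ c m b lt i →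
    inj₂ (inj₂ (inj₂ (inj₂ (inj₂ (inj₂ (inj₂
      ( code p                , lt (there (there (there (here refl))))
      , n                     , lt (there (there (there (there (here refl)))))
      , w                     , lt (there (there (there (there (there (here refl))))))
      , pair n w              , lt (there (there (there (there (there (there (here refl)))))))
      , iter (eval p) n w     , lt (there (there (there (there (there (there (there (here refl))))))))
      , sq-def 6 (code p) , pair-eq⁻¹ refl , pair-eq⁻¹ refl
      , fact-in _ _ _ (i (∈-++⁺ˡ F∋)) , fact-in _ _ _ (i (∈-++⁺ʳ F G∋))))))))))
    (justified-++ jF jG)

derivation pzero x = _ ∷ [] , here refl ,
  justified-∷ (justified-fact (sq 0 0) x 0 [] λ c m b lt i → inj₁ (sq-def 0 0 , refl)) justified-[]
derivation psuc x = _ ∷ [] , here refl ,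
  justified-∷ (justified-fact (sq 1 0) x (suc x) [] λ c m b lt i → inj₂ (inj₁ (sq-def 1 0 , refl))) justified-[]
derivation pfst x = _ ∷ [] , here refl ,
  justified-∷ (justified-fact (sq 2 0) x (π₁ x) (π₂ x ∷ []) λ c m b lt i → inj₂ (inj₂ (inj₁
    (sq-def 2 0 , π₂ x , lt (there (there (there (here refl)))) , pair-eq⁻¹ (sym (pair-unpair x)))))) justified-[]
derivation psnd x = _ ∷ [] , here refl ,
  justified-∷ (justified-fact (sq 3 0) x (π₂ x) (π₁ x ∷ []) λ c m b lt i → inj₂ (inj₂ (inj₂ (inj₁
    (sq-def 3 0 , π₁ x , lt (there (there (there (here refl)))) , pair-eq⁻¹ (sym (pair-unpair x))))))) justified-[]
derivation (ppair p q) x with derivation p x | derivation q x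
... | F , F∋ , jF | G , G∋ , jG = _ ∷ F ++ G , here refl ,
  justified-∷ (justified-fact _ x _ (code p ∷ code q ∷ eval p x ∷ eval q x ∷ []) λ c m b lt i →
    inj₂ (inj₂ (inj₂ (inj₂ (inj₁
      ( code p   , lt (there (there (there (here refl))))
      , code q   , lt (there (there (there (there (here refl)))))
      , eval p x , lt (there (there (there (there (there (here refl))))))
      , eval q x , lt (there (there (there (there (there (there (here refl)))))))
      , fact-def 4 (code p) (code q) , pair-eq⁻¹ refl
      , fact-in _ _ _ (i (∈-++⁺ˡ F∋)) , fact-in _ _ _ (i (∈-++⁺ʳ F G∋))))))))
    (justified-++ jF jG)
derivation (pcomp p q) x with derivation p (eval q x) | derivation q x
... | F , F∋ , jF | G , G∋ , jG = _ ∷ F ++ G , here refl ,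
  justified-∷ (justified-fact _ x _ (code p ∷ code q ∷ eval q x ∷ []) λ c m b lt i →
    inj₂ (inj₂ (inj₂ (inj₂ (inj₂ (inj₁
      ( code p   , lt (there (there (there (here refl))))
      , code q   , lt (there (there (there (there (here refl)))))
      , eval q x , lt (there (there (there (there (there (here refl))))))
      , fact-def 5 (code p) (code q)
      , fact-in _ _ _ (i (∈-++⁺ʳ F G∋)) , fact-in _ _ _ (i (∈-++⁺ˡ F∋)))))))))
    (justified-++ jF jG)
derivation (piter p) x with derivation-iter p (derivation p) (π₁ x) (π₂ x)
... | F , F∋ , jF = F , subst (λ x′ → fact (code (piter p)) x′ (eval (piter p) x) ∈ˡ F) (pair-unpair x) F∋ , jF

Cert : ℕ → ℕ → ℕ → ℕ → Set
Cert c m b z = Sat certF (c ∷ m ∷ b ∷ z ∷ [])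

cert-sound : ∀ {c m b} p {x y} → Cert c m b (fact (code p) x y) → y ≡ eval p x
cert-sound {c} {m} {b} p (i , j) = Soundness.sound (In c m b) justified p i
  where
  justified : ∀ e x y → In c m b (fact e x y) → Rule (In c m b) e x y
  justified e x y i with j (fact e x y) (proj₁ i)
  ... | inj₁ n = contradiction i n
  ... | inj₂ r = Just⇒Rule r

cert-complete : ∀ p x → ∃ λ c → ∃₂ λ m b → Cert c m b (fact (code p) x (eval p x))
cert-complete p x with derivation p x
... | F , F∋ , b₀ , jF = c , b ! , b , mem F∋ , justified
  where
  b c : ℕ
  b = b₀ ⊔ bound F
  c = setCode (b !) F
  F< : ∀ {y} → y ∈ˡ F → y < b
  F< i = ≤-trans (<-bound i) (m≤n⊔m b₀ (bound F))
  mem : ∀ {z} → z ∈ˡ F → In c (b !) b z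
  mem = member⇒In F F<
  justified : ∀ z → z < b → ¬ In c (b !) b z ⊎ Just c (b !) b z
  -- The disjunction in `certF` must be settled for each `z`, which is possible because membership
  -- is a bounded formula.
  justified z lt with bounded? (inF-bounded {c = v1} {v2} {v3} {v0}) (z ∷ c ∷ b ! ∷ b ∷ [])
  ... | no n  = inj₁ n
  ... | yes i = inj₂ (jF c (b !) b (m≤m⊔n b₀ (bound F)) mem (In⇒member F F< i))

-- Coded vectors and formulas for the graphs of programs

enc : ∀ {m} → Vec ℕ m → ℕ
enc []      = 0
enc (x ∷ ρ) = pair (enc ρ) x

decV : ∀ m → ℕ → Vec ℕ m
decV zero    w = []
decV (suc m) w = π₂ w ∷ decV m (π₁ w)

decV-enc : ∀ {m} (ρ : Vec ℕ m) → decV m (enc ρ) ≡ ρ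
decV-enc []      = refl
decV-enc (x ∷ ρ) = cong₂ _∷_ (π₂-pair (enc ρ) x) (trans (cong (decV _) (π₁-pair (enc ρ) x)) (decV-enc ρ))

compV-decV : ∀ m {u} → Comp u → CompV (λ w → decV m (u w))
compV-decV zero    cu = compV-[]
compV-decV (suc m) cu = compV-∷ (comp-π₂ cu) (compV-decV m (comp-π₁ cu))

evalT-wk : ∀ {k} (t : Term k) {y ρ} → evalT (wk t) (y ∷ ρ) ≡ evalT t ρ
evalT-wk (var i)  = refl
evalT-wk zer      = refl
evalT-wk (succ t) = cong suc (evalT-wk t)
evalT-wk (s ⊕ t)  = cong₂ _+_ (evalT-wk s) (evalT-wk t)
evalT-wk (s ⊗ t)  = cong₂ _*_ (evalT-wk s) (evalT-wk t)

evalT-# : ∀ {k} n {ρ : Vec ℕ k} → evalT (# n) ρ ≡ n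
evalT-# zero    = refl
evalT-# (suc n) = cong suc (evalT-# n)

evalV : ∀ {k n} → Vec (Term k) n → Vec ℕ k → Vec ℕ n
evalV ts ρ = V.map (λ t → evalT t ρ) ts

evalV-wk : ∀ {k n} (ts : Vec (Term k) n) {y ρ} → evalV (V.map wk ts) (y ∷ ρ) ≡ evalV ts ρ
evalV-wk []       = refl
evalV-wk (t ∷ ts) = cong₂ _∷_ (evalT-wk t) (evalV-wk ts)

-- The code of a tail is at most the code of the whole vector, so it can be sought below `succ z`
-- and the formula stays bounded.
encF : ∀ {k n} → Term k → Vec (Term k) n → Formula k
encF z []       = z ≐ zer
encF z (t ∷ ts) = bex (succ z) (pairF (wk z) v0 (wk t) ∧' encF v0 (V.map wk ts))

encF-bounded : ∀ {k n} (z : Term k) (ts : Vec (Term k) n) → Bounded (encF z ts)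
encF-bounded z []       = b-eq
encF-bounded z (t ∷ ts) = b-bex (b-and b-eq (encF-bounded v0 (V.map wk ts)))

encF-sound : ∀ {k n} (z : Term k) (ts : Vec (Term k) n) ρ → Sat (encF z ts) ρ → evalT z ρ ≡ enc (evalV ts ρ)
encF-sound z []       ρ s = s
encF-sound z (t ∷ ts) ρ (y , _ , p , s) = begin
  evalT z ρ                                      ≡⟨ sym (evalT-wk z) ⟩
  evalT (wk z) (y ∷ ρ)                           ≡⟨ pair-eq p ⟩
  pair y (evalT (wk t) (y ∷ ρ))                  ≡⟨ cong₂ pair (encF-sound v0 (V.map wk ts) (y ∷ ρ) s) (evalT-wk t) ⟩
  pair (enc (evalV (V.map wk ts) (y ∷ ρ))) (evalT t ρ) ≡⟨ cong (λ v → pair (enc v) (evalT t ρ)) (evalV-wk ts) ⟩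
  enc (evalV (t ∷ ts) ρ)                         ∎
  where open ≡-Reasoning

encF-complete : ∀ {k n} (z : Term k) (ts : Vec (Term k) n) ρ → evalT z ρ ≡ enc (evalV ts ρ) → Sat (encF z ts) ρ
encF-complete z []       ρ e = e
encF-complete z (t ∷ ts) ρ e =
  y , s≤s (≤-trans (fst≤pair y (evalT t ρ)) (≤-reflexive (sym e))) ,
  pair-eq⁻¹ (trans (evalT-wk z) (trans e (cong (pair y) (sym (evalT-wk t))))) ,
  encF-complete v0 (V.map wk ts) (y ∷ ρ) (cong enc (sym (evalV-wk ts)))
  where
  y : ℕ
  y = enc (evalV ts ρ)

-- The free variables are c, m, b, z, x, y and the entries of s.
graphMatrix : Prog → (n : ℕ) → Formula (6 + n)
graphMatrix p n = certF ∧' ((v3 ≐ factT (# code p) v4 v5) ∧' encF v4 (V.tabulate λ i → var (6 F.↑ʳ i)))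

graphF : Prog → (n : ℕ) → Formula (1 + n)
graphF p n = ex (ex (ex (ex (ex (graphMatrix p n)))))

graphF-Σ₁ : ∀ p n → IsΣ 1 (graphF p n)
graphF-Σ₁ p n = σ-ex (σ-ex (σ-ex (σ-ex (σ-ex (σ-base (π-zero
  (b-and certF-bounded (b-and b-eq (encF-bounded v4 (V.tabulate λ i → var (6 F.↑ʳ i)))))))))))

evalV-tabulate : ∀ {n} c m b z x y (s : Vec ℕ n) →
  evalV (V.tabulate λ i → var (6 F.↑ʳ i)) (c ∷ m ∷ b ∷ z ∷ x ∷ y ∷ s) ≡ s
evalV-tabulate c m b z x y s =
  trans (sym (tabulate-∘ (λ t → evalT t (c ∷ m ∷ b ∷ z ∷ x ∷ y ∷ s)) (λ i → var (6 F.↑ʳ i)))) (tabulate∘lookup s)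

graphF-correct : ∀ {u} ((p , _) : Comp u) {n} (s : Vec ℕ n) y → Sat (graphF p n) (y ∷ s) ⇔ (u (enc s) ≡ y)
graphF-correct {u} (p , e) {n} s y = mk⇔ to from
  where
  factT≡ : ∀ c m b z x → evalT (factT (# code p) v4 v5) (c ∷ m ∷ b ∷ z ∷ x ∷ y ∷ s) ≡ fact (code p) x y
  factT≡ c m b z x =
    trans (cong (λ k → (k + ((x + y) * (x + y) + x)) * (k + ((x + y) * (x + y) + x)) + k) (evalT-# (code p)))
          (sym (fact-def (code p) x y))
  to : Sat (graphF p n) (y ∷ s) → u (enc s) ≡ y
  to (x , z , b , m , c , cert , z≡ , x≡) =
    trans (sym (e (enc s))) (trans (cong (eval p) (sym x≡enc))
      (sym (cert-sound p (subst (Cert c m b) (trans z≡ (factT≡ c m b z x)) cert))))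
    where
    x≡enc : x ≡ enc s
    x≡enc = trans (encF-sound v4 (V.tabulate λ i → var (6 F.↑ʳ i)) _ x≡) (cong enc (evalV-tabulate c m b z x y s))
  from : u (enc s) ≡ y → Sat (graphF p n) (y ∷ s)
  from eq with cert-complete p (enc s)
  ... | c , m , b , cert = enc s , z , b , m , c , subst (λ y → Cert c m b (fact (code p) (enc s) y)) (trans (e _) eq) cert ,
    sym (factT≡ c m b z (enc s)) ,
    encF-complete v4 (V.tabulate λ i → var (6 F.↑ʳ i)) _ (cong enc (sym (evalV-tabulate c m b z (enc s) y s)))
    where
    z : ℕ
    z = fact (code p) (enc s) y

-- Indices of Σ_n predicates

comp-sq : ∀ {u w} → Comp u → Comp w → Comp (λ z → sq (u z) (w z))
comp-sq cu cw = comp-ext (λ z → sym (sq-def _ _)) (comp-+ (comp-* (comp-+ cu cw) (comp-+ cu cw)) cu)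

dec-≡1 : ∀ {P} (d : DecC P) z → P z → χ d z ≡ 1
dec-≡1 d z p with spec d z
... | inj₁ (_ , e) = e
... | inj₂ (n , _) = contradiction p n

≡1-dec : ∀ {P} (d : DecC P) z → χ d z ≡ 1 → P z
≡1-dec d z e with spec d z
... | inj₁ (p , _)  = p
... | inj₂ (_ , e′) = contradiction (trans (sym e) e′) 1+n≢0

-- L₀ e (pair v t) says that t certifies that the program coded by e outputs 1 on pair v y for some y.
abstract
  L₀ : ℕ → ℕ → Set
  L₀ e u = Cert (π₁ (π₂ t)) (π₁ (π₂ (π₂ t))) (π₂ (π₂ (π₂ t))) (fact e (pair (π₁ u) (π₁ t)) 1)
    where
    t : ℕ
    t = π₂ u

  dec-L₀ : ∀ {e u} → Comp e → Comp u → DecC (λ w → L₀ (e w) (u w))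
  dec-L₀ {e} {u} ce cu = dec-bounded (certF-bounded {0})
    (compV-∷ (comp-π₁ (comp-π₂ ct)) (compV-∷ (comp-π₁ (comp-π₂ (comp-π₂ ct))) (compV-∷ (comp-π₂ (comp-π₂ (comp-π₂ ct)))
      (compV-∷ (comp-sq ce (comp-sq (comp-pair (comp-π₁ cu) (comp-π₁ ct)) (comp-const 1))) compV-[]))))
    where
    ct : Comp (λ w → π₂ (u w))
    ct = comp-π₂ cu

  L₀-intro : ∀ p v y → eval p (pair v y) ≡ 1 → ∃ λ t → L₀ (code p) (pair v t)
  L₀-intro p v y eq with cert-complete p (pair v y)
  ... | c , m , b , cert = t , decoded
    where
    t : ℕ
    t = pair y (pair c (pair m b))
    decoded : L₀ (code p) (pair v t)
    decoded rewrite π₁-pair v t | π₂-pair v t | π₁-pair y (pair c (pair m b)) | π₂-pair y (pair c (pair m b))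
      | π₁-pair c (pair m b) | π₂-pair c (pair m b) | π₁-pair m b | π₂-pair m b | sym eq = cert

  L₀-elim : ∀ p v t → L₀ (code p) (pair v t) → ∃ λ y → eval p (pair v y) ≡ 1
  L₀-elim p v t l with cert-sound p l
  ... | eq = π₁ (π₂ (pair v t)) , trans (cong (λ v′ → eval p (pair v′ (π₁ (π₂ (pair v t))))) (sym (π₁-pair v t))) (sym eq)

module _ {P : ℕ → Set} (d : DecC P) where

  prog : Prog
  prog = proj₁ (comp d)

  L₀-of : ∀ v y → P (pair v y) → ∃ λ t → L₀ (code prog) (pair v t)
  L₀-of v y p = L₀-intro prog v y (trans (proj₂ (comp d) _) (dec-≡1 d _ p))

  of-L₀ : ∀ v t → L₀ (code prog) (pair v t) → ∃ λ y → P (pair v y)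
  of-L₀ v t l with L₀-elim prog v t l
  ... | y , eq = y , ≡1-dec d _ (trans (sym (proj₂ (comp d) _)) eq)

-- The Π_d predicates of an index e, in negative form.
L : ℕ → ℕ → ℕ → Set
L zero    e u = L₀ e u
L (suc d) e v = ∀ a → ¬ L d e (pair v a)

-- From ¬ L (suc d) to a witness for d < k: the amount of Markov's principle needed to read L k back as a formula.
Markov : ℕ → Set
Markov k = ∀ d → d < k → ∀ e v → ¬ L (suc d) e v → ∃ λ a → L d e (pair v a)

-- The outer quantifier over `b` is there to absorb a block of universal quantifiers of `χ`. The
-- right-hand side is `L (suc k) e v`; being negative, it gives back witnesses inside `χ` only with
-- Markov's principle.
Π-index : ∀ {m} (χ : Formula m) (g : ℕ → Vec ℕ m) (k e : ℕ) → Set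
Π-index χ g k e = ∀ v →
  ((∀ b → Sat χ (g (pair v b))) → ∀ b → ¬ L k e (pair v b)) ×
  (Markov k → (∀ b → ¬ L k e (pair v b)) → ∀ b → Sat χ (g (pair v b)))

Σ-index : ∀ {m} (χ : Formula m) (g : ℕ → Vec ℕ m) (k e : ℕ) → Set
Σ-index χ g k e = ∀ v →
  ((∃ λ b → Sat χ (g (pair v b))) → ∃ λ b → L k e (pair v b)) ×
  (Markov (pred k) → (∃ λ b → L k e (pair v b)) → ∃ λ b → Sat χ (g (pair v b)))

-- A block of like quantifiers is collected into one: this splits off the innermost component.
regroup : ℕ → ℕ
regroup u = pair (π₁ u) (π₁ (π₂ u))

comp-regroup : Comp regroup
comp-regroup = comp-pair (comp-π₁ comp-id) (comp-π₁ (comp-π₂ comp-id))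

regroupV : ∀ {m} → (ℕ → Vec ℕ m) → ℕ → Vec ℕ (suc m)
regroupV g u = π₂ (π₂ u) ∷ g (regroup u)

compV-regroup : ∀ {m} {g : ℕ → Vec ℕ m} → CompV g → CompV (regroupV g)
compV-regroup cg = compV-∷ (comp-π₂ (comp-π₂ comp-id)) (compV-∘ cg comp-regroup)

regroup-pair : ∀ {m} (g : ℕ → Vec ℕ m) v b y → regroupV g (pair v (pair b y)) ≡ y ∷ g (pair v b)
regroup-pair g v b y rewrite π₂-pair v (pair b y) | π₁-pair v (pair b y) | π₁-pair b y | π₂-pair b y = refl

regroup-unpair : ∀ {m} (g : ℕ → Vec ℕ m) v b → regroupV g (pair v b) ≡ π₂ b ∷ g (pair v (π₁ b))
regroup-unpair g v b rewrite π₂-pair v b | π₁-pair v b = refl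

Π-block : ∀ {k m} {χ : Formula m} → IsΠ (suc k) χ → ∀ {g} → CompV g → ∃ (Π-index χ g k)
Σ-block : ∀ {k m} {χ : Formula m} → IsΣ (suc k) χ → ∀ {g} → CompV g → ∃ (Σ-index χ g k)

-- The program searches for counterexamples, since `L 1` denies that a search succeeds.
Π-block {zero} {χ = χ} (π-base (σ-zero b)) {g} cg = code (prog d) , λ v →
  (λ s t l → let y , n = of-L₀ d v t l in n (s y)) ,
  λ _ n y → case bounded? b (g (pair v y)) of λ where
    (yes s) → s
    (no ¬s) → let t , l = L₀-of d v y ¬s in contradiction l (n t)
  where
  d : DecC (λ u → ¬ Sat χ (g u))
  d = dec-¬ (dec-bounded b cg)
-- The Σ-formula gets a dummy block variable, which `π₁` discards and for which 0 is a witness.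
Π-block {suc k} {χ = χ} (π-base s) {g} cg with Σ-block s (compV-∘ cg (comp-π₁ comp-id))
... | e , r = e , λ v →
  (λ s b l → let a , l′ = proj₁ (r (pair v b)) (0 , subst (λ u → Sat χ (g u)) (sym (π₁-pair _ 0)) (s b)) in l a l′) ,
  λ mk n b → let a , s = proj₂ (r (pair v b)) (λ d lt → mk d (≤-trans lt (≤-trans pred[n]≤n (n≤1+n k))))
                               (mk k ≤-refl e (pair v b) (n b))
             in subst (λ u → Sat χ (g u)) (π₁-pair _ a) s
Π-block {k} (π-all {φ = χ} p) {g} cg with Π-block p (compV-regroup cg)
... | e , r = e , λ v →
  (λ s → proj₁ (r v) λ b → subst (Sat χ) (sym (regroup-unpair g v b)) (s (π₁ b) (π₂ b))) ,
  λ mk n b y → subst (Sat χ) (regroup-pair g v b y) (proj₂ (r v) mk n (pair b y))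

Σ-block {zero} {χ = χ} (σ-base (π-zero b)) {g} cg = code (prog d) , λ v →
  (λ (y , s) → L₀-of d v y s) , λ _ (t , l) → of-L₀ d v t l
  where
  d : DecC (λ u → Sat χ (g u))
  d = dec-bounded b cg
Σ-block {suc k} {χ = χ} (σ-base p) {g} cg with Π-block p (compV-∘ cg (comp-π₁ comp-id))
... | e , r = e , λ v →
  (λ (b , s) → b , proj₁ (r (pair v b)) λ a → subst (λ u → Sat χ (g u)) (sym (π₁-pair _ a)) s) ,
  λ mk (b , l) → b , subst (λ u → Sat χ (g u)) (π₁-pair _ 0) (proj₂ (r (pair v b)) mk l 0)
Σ-block {k} (σ-ex {φ = χ} p) {g} cg with Σ-block p (compV-regroup cg)
... | e , r = e , λ v →
  (λ (b , y , s) → proj₁ (r v) (pair b y , subst (Sat χ) (sym (regroup-pair g v b y)) s)) ,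
  λ mk l → let b , s = proj₂ (r v) mk l in π₁ b , π₂ b ,
    subst (Sat χ) (regroup-unpair g v b) s

-- The diagonal colouring

-- The decidable approximation to `L` that is visible from an n-set: the elements after the first
-- bound the quantifiers, outermost first.
Lb : ∀ d → Vec ℕ d → ℕ → ℕ → Set
Lb zero    ys e v = L₀ e v
Lb (suc d) ys e v = ∀ a → a < lookup ys F.zero → ¬ Lb d (V.tail ys) e (pair v a)

compV-tail : ∀ {m} {g : ℕ → Vec ℕ (suc m)} → CompV g → CompV (λ w → V.tail (g w))
compV-tail {g = g} cg .entry i = comp-ext (λ w → eq (g w)) (entry cg (F.suc i))
  where
  eq : ∀ ρ → lookup ρ (F.suc i) ≡ lookup (V.tail ρ) i
  eq (_ ∷ _) = refl

dec-Lb : ∀ d {ys : ℕ → Vec ℕ d} {e v : ℕ → ℕ} → CompV ys → Comp e → Comp v → DecC (λ w → Lb d (ys w) (e w) (v w))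
dec-Lb zero    cy ce cv = dec-L₀ ce cv
dec-Lb (suc d) {ys} {e} {v} cy ce cv = dec-∀< {Q = λ w a → ¬ Lb d (V.tail (ys w)) (e w) (pair (v w) a)} (entry cy F.zero)
  (dec-¬ (dec-Lb d (compV-∘ (compV-tail cy) (comp-π₁ comp-id)) (comp-∘ ce (comp-π₁ comp-id))
    (comp-pair (comp-∘ cv (comp-π₁ comp-id)) (comp-π₂ comp-id))))

-- Seen with the bounds ys, raising the leading bound beyond x changes no statement of level at most m with codes below r.
Stable : ∀ m → ℕ → ℕ → Vec ℕ m → Set
Stable zero    r x ys = ⊤
Stable (suc m) r x ys =
  (∀ e → e < r → ∀ v → v < r → Lb (suc m) (x ∷ V.tail ys) e v → Lb (suc m) ys e v) × Stable m r x (V.tail ys)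

dec-Stable : ∀ m {r x : ℕ → ℕ} {ys : ℕ → Vec ℕ m} → Comp r → Comp x → CompV ys → DecC (λ w → Stable m (r w) (x w) (ys w))
dec-Stable zero    cr cx cy = dec-⊤
dec-Stable (suc m) {r} {x} {ys} cr cx cy = dec-×
  (dec-∀< {Q = λ w e → ∀ v → v < r w → Lb (suc m) (x w ∷ V.tail (ys w)) e v → Lb (suc m) (ys w) e v} cr
    (dec-∀< {Q = λ w v → Lb (suc m) (x (π₁ w) ∷ V.tail (ys (π₁ w))) (π₂ w) v → Lb (suc m) (ys (π₁ w)) (π₂ w) v}
      (comp-∘ cr (comp-π₁ comp-id))
      (dec-→ (dec-Lb (suc m) (compV-∘ (compV-∷ cx (compV-tail cy)) (comp-π₁ (comp-π₁ comp-id)))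
                     (comp-π₂ (comp-π₁ comp-id)) (comp-π₂ comp-id))
             (dec-Lb (suc m) (compV-∘ cy (comp-π₁ (comp-π₁ comp-id)))
                     (comp-π₂ (comp-π₁ comp-id)) (comp-π₂ comp-id)))))
  (dec-Stable m cr cx (compV-tail cy))

nth : ℕ → ℕ → ℕ
nth d i = π₁ (iter π₂ i d)

comp-nth : ∀ {d i} → Comp d → Comp i → Comp (λ w → nth (d w) (i w))
comp-nth cd ci = comp-π₁ (comp-iter (comp-π₂ (comp-π₂ comp-id)) ci cd)

-- d lists 2 ^ r pairs (x , a) with distinct x, where a witnesses that x is in the set with index π₁ r.
Good : ∀ m → ℕ → ℕ → Vec ℕ (suc m) → Set
Good m r d ys = ∀ i → i < 2 ^ r →
  Lb (suc m) ys (π₁ r) (nth d i) × Stable m r (π₁ (nth d i)) (V.tail ys) ×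
  (∀ j → j < i → π₁ (nth d j) ≢ π₁ (nth d i))

dec-Good : ∀ m {r d : ℕ → ℕ} {ys : ℕ → Vec ℕ (suc m)} → Comp r → Comp d → CompV ys → DecC (λ w → Good m (r w) (d w) (ys w))
dec-Good m {r} {d} {ys} cr cd cy =
  dec-∀< {Q = λ w i → Lb (suc m) (ys w) (π₁ (r w)) (nth (d w) i) × Stable m (r w) (π₁ (nth (d w) i)) (V.tail (ys w)) ×
    (∀ j → j < i → π₁ (nth (d w) j) ≢ π₁ (nth (d w) i))} (comp-2^ cr)
  (dec-× (dec-Lb (suc m) (compV-∘ cy p) (comp-π₁ (comp-∘ cr p)) (comp-nth (comp-∘ cd p) (comp-π₂ comp-id)))
  (dec-× (dec-Stable m (comp-∘ cr p) (comp-π₁ (comp-nth (comp-∘ cd p) (comp-π₂ comp-id))) (compV-tail (compV-∘ cy p)))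
         (dec-∀< {Q = λ w j → π₁ (nth (d (π₁ w)) j) ≢ π₁ (nth (d (π₁ w)) (π₂ w))} (comp-π₂ comp-id)
           (dec-¬ (dec-≡ (comp-π₁ (comp-nth (comp-∘ cd pp) (comp-π₂ comp-id)))
                         (comp-π₁ (comp-nth (comp-∘ cd pp) (comp-π₂ p))))))))
  where
  p : Comp π₁
  p = comp-π₁ comp-id
  pp : Comp (λ w → π₁ (π₁ w))
  pp = comp-π₁ p

-- Only the least good list counts, which limits a requirement `r` to `2 ^ r` candidates.
Candidate : ∀ m → ℕ → ℕ → Vec ℕ (suc m) → Set
Candidate m r x ys = ∃ λ d → d < lookup ys F.zero × Good m r d ys × (∀ d′ → d′ < d → ¬ Good m r d′ ys) ×
  ∃ λ i → i < 2 ^ r × x ≡ π₁ (nth d i)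

dec-Candidate : ∀ m {r x : ℕ → ℕ} {ys : ℕ → Vec ℕ (suc m)} → Comp r → Comp x → CompV ys →
                DecC (λ w → Candidate m (r w) (x w) (ys w))
dec-Candidate m {r} {x} {ys} cr cx cy =
  dec-∃< {Q = λ w d → Good m (r w) d (ys w) × (∀ d′ → d′ < d → ¬ Good m (r w) d′ (ys w)) ×
                      ∃ λ i → i < 2 ^ r w × x w ≡ π₁ (nth d i)} (entry cy F.zero)
  (dec-× (dec-Good m (comp-∘ cr p) (comp-π₂ comp-id) (compV-∘ cy p))
  (dec-× (dec-∀< {Q = λ w d′ → ¬ Good m (r (π₁ w)) d′ (ys (π₁ w))} (comp-π₂ comp-id)
           (dec-¬ (dec-Good m (comp-∘ cr pp) (comp-π₂ comp-id) (compV-∘ cy pp))))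
         (dec-∃< {Q = λ w i → x (π₁ w) ≡ π₁ (nth (π₂ w) i)} (comp-2^ (comp-∘ cr p))
           (dec-≡ (comp-∘ cx pp) (comp-π₁ (comp-nth (comp-π₂ p) (comp-π₂ comp-id)))))))
  where
  p : Comp π₁
  p = comp-π₁ comp-id
  pp : Comp (λ w → π₁ (π₁ w))
  pp = comp-π₁ p

-- Priority: a number claimed by several requirements obeys the smallest, so that no two prescribe
-- its colour.
Marker : ∀ m → ℕ → ℕ → Vec ℕ (suc m) → Set
Marker m r x ys = Candidate m r x ys × (∀ r′ → r′ < r → ¬ Candidate m r′ x ys)

dec-Marker : ∀ m {r x : ℕ → ℕ} {ys : ℕ → Vec ℕ (suc m)} → Comp r → Comp x → CompV ys →
             DecC (λ w → Marker m (r w) (x w) (ys w))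
dec-Marker m {r} {x} {ys} cr cx cy = dec-× (dec-Candidate m cr cx cy)
  (dec-∀< {Q = λ w r′ → ¬ Candidate m r′ (x w) (ys w)} cr
    (dec-¬ (dec-Candidate m (comp-π₂ comp-id) (comp-∘ cx (comp-π₁ comp-id)) (compV-∘ cy (comp-π₁ comp-id)))))

-- The requirement r concerns the set with index π₁ r, and asks for the colour Low if π₂ r = 0 and for its negation otherwise.
Low : ∀ m → ℕ → Vec ℕ (suc m) → Set
Low m x ys = ¬ Stable m x (lookup ys F.zero) (V.tail ys) ⊎
  ∃ λ r → r < lookup ys F.zero × π₂ r ≡ 0 × Marker m r x ys

dec-Low : ∀ m {x : ℕ → ℕ} {ys : ℕ → Vec ℕ (suc m)} → Comp x → CompV ys → DecC (λ w → Low m (x w) (ys w))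
dec-Low m {x} {ys} cx cy = dec-⊎ (dec-¬ (dec-Stable m cx (entry cy F.zero) (compV-tail cy)))
  (dec-∃< {Q = λ w r → π₂ r ≡ 0 × Marker m r (x w) (ys w)} (entry cy F.zero)
    (dec-× (dec-≡ (comp-π₂ (comp-π₂ comp-id)) (comp-const 0))
           (dec-Marker m (comp-π₂ comp-id) (comp-∘ cx (comp-π₁ comp-id)) (compV-∘ cy (comp-π₁ comp-id)))))

-- Convergence of the bounded approximations

em : (P : Set) → ¬ ¬ (P ⊎ ¬ P)
em P n = n (inj₂ (n ∘ inj₁))

-- P holds for all ys such that each entry is large enough in terms of the previous ones.
Far : ∀ m → (Vec ℕ m → Set) → Set
Far zero    P = ¬ ¬ P []
Far (suc m) P = ¬ ¬ (∃ λ t → ∀ y → t ≤ y → Far m (λ ys → P (y ∷ ys)))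

far-pure : ∀ m {P : Vec ℕ m → Set} → (∀ ys → P ys) → Far m P
far-pure zero    f k = k (f [])
far-pure (suc m) f k = k (0 , λ y _ → far-pure m (λ ys → f (y ∷ ys)))

far-zip : ∀ m {P Q R : Vec ℕ m → Set} → (∀ ys → P ys → Q ys → R ys) → Far m P → Far m Q → Far m R
far-zip zero    f p q k = p λ x → q λ y → k (f [] x y)
far-zip (suc m) f p q k = p λ (t , h) → q λ (t′ , h′) → k (t ⊔ t′ , λ y le →
  far-zip m (λ ys → f (y ∷ ys)) (h y (≤-trans (m≤m⊔n t t′) le)) (h′ y (≤-trans (m≤n⊔m t t′) le)))

far-¬¬ : ∀ m {P : Vec ℕ m → Set} → ¬ ¬ Far m P → Far m P
far-¬¬ zero    h k = h λ e → e k
far-¬¬ (suc m) h k = h λ e → e k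

-- Far is wrapped in a record so that P can be inferred from Ev m P.
record Ev (m : ℕ) (P : Vec ℕ m → Set) : Set where
  constructor ev
  field far : Far m P
open Ev

ev-pure : ∀ m {P : Vec ℕ m → Set} → (∀ ys → P ys) → Ev m P
ev-pure m f = ev (far-pure m f)

ev-zip : ∀ m {P Q R : Vec ℕ m → Set} → (∀ ys → P ys → Q ys → R ys) → Ev m P → Ev m Q → Ev m R
ev-zip m f (ev p) (ev q) = ev (far-zip m f p q)

ev-map : ∀ m {P Q : Vec ℕ m → Set} → (∀ ys → P ys → Q ys) → Ev m P → Ev m Q
ev-map m f p = ev-zip m (λ ys x _ → f ys x) p p

ev-¬¬ : ∀ m {P : Vec ℕ m → Set} → ¬ ¬ Ev m P → Ev m P
ev-¬¬ m h = ev (far-¬¬ m λ k → h λ e → k (far e))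

ev-∷ : ∀ m {P : Vec ℕ (suc m) → Set} → ¬ ¬ (∃ λ t → ∀ y → t ≤ y → Ev m (λ ys → P (y ∷ ys))) → Ev (suc m) P
ev-∷ m h = ev λ k → h λ (t , f) → k (t , λ y le → far (f y le))

-- `Ev` absorbs double negations, so `P` may be decided classically.
ev-→ : ∀ m {P : Set} {Q : Vec ℕ m → Set} → (P → Ev m Q) → Ev m (λ ys → P → Q ys)
ev-→ m {P} f = ev-¬¬ m λ k → em P λ where
  (inj₁ p) → k (ev-map m (λ _ q _ → q) (f p))
  (inj₂ n) → k (ev-pure m (λ _ p → contradiction p n))

ev-∀< : ∀ m N {P : ℕ → Vec ℕ m → Set} → (∀ i → i < N → Ev m (P i)) → Ev m (λ ys → ∀ i → i < N → P i ys)
ev-∀< m zero    f = ev-pure m λ _ _ ()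
ev-∀< m (suc N) f = ev-zip m
  (λ ys h p i lt → case m<1+n⇒m<n∨m≡n lt of λ { (inj₁ l) → h i l ; (inj₂ refl) → p })
  (ev-∀< m N (λ i lt → f i (m<n⇒m<1+n lt))) (f N ≤-refl)

ev-tail : ∀ m {P : Vec ℕ m → Set} → Ev m P → Ev (suc m) (λ ys → P (V.tail ys))
ev-tail m e = ev-∷ m λ k → k (0 , λ _ _ → e)

-- If `L (suc d) e v` holds, a leading bound `y` leaves finitely many instances for the later bounds
-- to get right. If it fails, every leading bound beyond a counterexample shows this.
Lb⇔L : ∀ d e v → Ev d (λ ys → (Lb d ys e v → L d e v) × (L d e v → Lb d ys e v))
Lb⇔L zero    e v = ev-pure zero λ _ → id , id
Lb⇔L (suc d) e v = ev-∷ d λ k → em (L (suc d) e v) λ where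
  (inj₁ l) → k (0 , λ y _ → ev-map d (λ ys h → (λ _ → l) , λ _ a lt lb → l a (h a lt lb))
    (ev-∀< d y λ a _ → ev-map d (λ _ → proj₁) (Lb⇔L d e (pair v a))))
  (inj₂ n) → n λ a l → k (suc a , λ y a<y →
    ev-map d (λ ys h → (λ lb → contradiction (proj₂ h l) (lb a a<y)) , λ l′ → contradiction l′ n) (Lb⇔L d e (pair v a)))

-- The limit form of one level of `Stable`: a search below `x` is as good as an unbounded one, for
-- codes below `r`.
Settles : ℕ → ℕ → ℕ → Set
Settles d r x = ∀ e → e < r → ∀ v → v < r → (∀ a → a < x → ¬ L d e (pair v a)) → L (suc d) e v

AllSettles : ℕ → ℕ → ℕ → Set
AllSettles m r x = ∀ d → d < m → Settles d r x

allSettles-mono : ∀ {m r r′ x x′} → r′ ≤ r → x ≤ x′ → AllSettles m r x → AllSettles m r′ x′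
allSettles-mono r≤ x≤ s d d< e e< v v< h =
  s d d< e (≤-trans e< r≤) v (≤-trans v< r≤) (λ a lt → h a (≤-trans lt x≤))

-- The conclusion `L (suc d) e v` is negative. A concrete `x` may therefore be shown to settle by a
-- classical argument.
allSettles-¬¬ : ∀ {m r x} → ¬ ¬ AllSettles m r x → AllSettles m r x
allSettles-¬¬ k d d< e e< v v< h a l = k λ s → s d d< e e< v v< h a l

eventually-∀< : ∀ N {P : ℕ → ℕ → Set} → (∀ {i x y} → x ≤ y → P i x → P i y) →
                (∀ i → i < N → ¬ ¬ ∃ (P i)) → ¬ ¬ ∃ λ x → ∀ i → i < N → P i x
eventually-∀< zero    mono f k = k (0 , λ _ ())
eventually-∀< (suc N) mono f k =
  eventually-∀< N mono (λ i lt → f i (m<n⇒m<1+n lt)) λ (x , h) → f N ≤-refl λ (y , p) →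
  k (x ⊔ y , λ i lt → case m<1+n⇒m<n∨m≡n lt of λ where
    (inj₁ l)    → mono (m≤m⊔n x y) (h i l)
    (inj₂ refl) → mono (m≤n⊔m x y) p)

allSettles-eventually : ∀ m r → ¬ ¬ ∃ (AllSettles m r)
allSettles-eventually m r =
  eventually-∀< m {λ d → Settles d r} (λ le s e e< v v< h → s e e< v v< (λ a lt → h a (≤-trans lt le))) λ d _ →
  eventually-∀< r {λ e x → ∀ v → v < r → (∀ a → a < x → ¬ L d e (pair v a)) → L (suc d) e v}
    (λ le s v v< h → s v v< (λ a lt → h a (≤-trans lt le))) λ e _ →
  eventually-∀< r {λ v x → (∀ a → a < x → ¬ L d e (pair v a)) → L (suc d) e v}
    (λ le s h → s (λ a lt → h a (≤-trans lt le))) λ v _ → single d e v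
  where
  single : ∀ d e v → ¬ ¬ ∃ λ x → (∀ a → a < x → ¬ L d e (pair v a)) → L (suc d) e v
  single d e v k = em (L (suc d) e v) λ where
    (inj₁ l) → k (0 , λ _ → l)
    (inj₂ n) → n λ a l → k (suc a , λ h → contradiction l (h a ≤-refl))

-- Far out, the verdicts on the finitely many instances below `x` are correct; `Settles` extends
-- them to the full statement, which large leading bounds see correctly by `Lb⇔L`.
settles⇒stable : ∀ m {r x} → AllSettles m r x → Ev m (Stable m r x)
settles⇒stable zero    s = ev-pure zero λ _ → tt
settles⇒stable (suc m) {r} {x} s = ev-zip (suc m) (λ _ → _,_) leading
  (ev-tail m (settles⇒stable m (λ d lt → s d (m<n⇒m<1+n lt))))
  where
  leading : Ev (suc m) (λ ys → ∀ e → e < r → ∀ v → v < r → Lb (suc m) (x ∷ V.tail ys) e v → Lb (suc m) ys e v)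
  leading = ev-∀< (suc m) r λ e e< → ev-∀< (suc m) r λ v v< →
    ev-zip (suc m) (λ ys h c lb → proj₂ c (s m ≤-refl e e< v v< (λ a lt l → lb a lt (h a lt l))))
      (ev-tail m (ev-∀< m x λ a _ → ev-map m (λ _ → proj₂) (Lb⇔L m e (pair v a))))
      (Lb⇔L (suc m) e v)

-- This direction makes the colour informative: if `x` does not settle, sufficiently distant bounds
-- expose it as unstable.
stable⇒settles : ∀ m r x → Ev m (λ ys → Stable m r x ys → AllSettles m r x)
stable⇒settles zero    r x = ev-pure zero λ _ _ _ ()
stable⇒settles (suc m) r x = ev-zip (suc m)
  (λ ys f g (p , q) d lt → case m<1+n⇒m<n∨m≡n lt of λ { (inj₁ l) → g q d l ; (inj₂ refl) → f p })
  leading (ev-tail m (stable⇒settles m r x))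
  where
  leading : Ev (suc m) (λ ys →
    (∀ e → e < r → ∀ v → v < r → Lb (suc m) (x ∷ V.tail ys) e v → Lb (suc m) ys e v) → Settles m r x)
  leading = ev-map (suc m) (λ ys h f e e< v v< → h e e< v v< (f e e< v v<))
    (ev-∀< (suc m) r λ e e< → ev-→∀ e)
    where
    ev-→∀ : ∀ e → Ev (suc m) (λ ys → ∀ v → v < r → (Lb (suc m) (x ∷ V.tail ys) e v → Lb (suc m) ys e v) →
                     (∀ a → a < x → ¬ L m e (pair v a)) → L (suc m) e v)
    ev-→∀ e = ev-∀< (suc m) r λ v v< →
      ev-zip (suc m) (λ ys h c f n → proj₁ c (f (λ a lt lb → n a lt (h a lt lb))))
        (ev-tail m (ev-∀< m x λ a _ → ev-map m (λ _ → proj₁) (Lb⇔L m e (pair v a))))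
        (Lb⇔L (suc m) e v)

GoodL : ∀ m → ℕ → ℕ → Set
GoodL m r d = ∀ i → i < 2 ^ r →
  L (suc m) (π₁ r) (nth d i) × AllSettles m r (π₁ (nth d i)) ×
  (∀ j → j < i → π₁ (nth d j) ≢ π₁ (nth d i))

Good⇔GoodL : ∀ m r d → Ev (suc m) (λ ys → (Good m r d ys → GoodL m r d) × (GoodL m r d → Good m r d ys))
Good⇔GoodL m r d = ev-map (suc m) transfer
  (ev-∀< (suc m) (2 ^ r) {P = Agree} λ i _ →
    ev-zip (suc m) (λ ys (f , g) (f′ , g′) → f , f′ , g , g′) (Lb⇔L (suc m) (π₁ r) (nth d i))
      (ev-tail m (ev-zip m (λ _ → _,_) (stable⇒settles m r (π₁ (nth d i)))
                                       (ev-→ m (settles⇒stable m)))))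
  where
  Agree : ℕ → Vec ℕ (suc m) → Set
  Agree i ys =
    (Lb (suc m) ys (π₁ r) (nth d i) → L (suc m) (π₁ r) (nth d i)) ×
    (Stable m r (π₁ (nth d i)) (V.tail ys) → AllSettles m r (π₁ (nth d i))) ×
    (L (suc m) (π₁ r) (nth d i) → Lb (suc m) ys (π₁ r) (nth d i)) ×
    (AllSettles m r (π₁ (nth d i)) → Stable m r (π₁ (nth d i)) (V.tail ys))

  transfer : ∀ ys → (∀ i → i < 2 ^ r → Agree i ys) → (Good m r d ys → GoodL m r d) × (GoodL m r d → Good m r d ys)
  transfer ys h =
    (λ g i lt → let a , b , c = g i lt ; f , f′ , _ = h i lt in f a , f′ b , c) ,
    (λ g i lt → let a , b , c = g i lt ; _ , _ , f , f′ = h i lt in f a , f′ b , c)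

-- For fixed `r`, any large leading entry of `ys` is itself a settling bound. With `r` as the first
-- element of the n-set, the first alternative of `Low` fails far out.
stable-eventually : ∀ m r → Ev (suc m) (λ ys → Stable m r (lookup ys F.zero) (V.tail ys))
stable-eventually m r = ev-∷ m λ k → allSettles-eventually m r λ (x , s) →
  k (x , λ y le → settles⇒stable m (allSettles-mono ≤-refl le s))

-- Sets avoiding a colour of the diagonal colouring

stable-mono : ∀ m {r r′ x} {ys : Vec ℕ m} → r′ ≤ r → Stable m r x ys → Stable m r′ x ys
stable-mono zero    le s = tt
stable-mono (suc m) le (s , s′) =
  (λ e e< v v< → s e (≤-trans e< le) v (≤-trans v< le)) , stable-mono m le s′

candidate? : ∀ m r x ys → Dec (Candidate m r x ys)
candidate? m r x ys = dec (dec-Candidate m (comp-const r) (comp-const x) (compV-const ys)) 0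

marker-unique : ∀ m {r r′ x ys} → Marker m r x ys → Marker m r′ x ys → r ≡ r′
marker-unique m {r} {r′} (c , n) (c′ , n′) with <-cmp r r′
... | tri< lt _ _ = contradiction c (n′ r lt)
... | tri≈ _ e _  = e
... | tri> _ _ gt = contradiction c′ (n r′ gt)

-- The candidates for r are indexed by i < 2 ^ r, and the numbers 2 ^ r + i with r < q lie between 1 and 2 ^ q ∸ 1.
slot-below : ∀ {r i q} → i < 2 ^ r → r < q → 2 ^ r + i < 2 ^ q
slot-below {r} {i} {q} i< r<q = begin-strict
  2 ^ r + i       <⟨ +-monoʳ-< (2 ^ r) i< ⟩
  2 ^ r + 2 ^ r   ≡⟨ cong (2 ^ r +_) (sym (+-identityʳ (2 ^ r))) ⟩
  2 ^ suc r       ≤⟨ ^-monoʳ-≤ 2 r<q ⟩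
  2 ^ q           ∎
  where open ≤-Reasoning

slot-injective : ∀ {r i r′ i′} → i < 2 ^ r → i′ < 2 ^ r′ → 2 ^ r + i ≡ 2 ^ r′ + i′ → r ≡ r′ × i ≡ i′
slot-injective {r} {i} {r′} {i′} i< i′< eq with <-cmp r r′
... | tri< lt _ _   = contradiction eq (<⇒≢ (≤-trans (slot-below i< lt) (m≤m+n (2 ^ r′) i′)))
... | tri≈ _ refl _ = refl , +-cancelˡ-≡ (2 ^ r) i i′ eq
... | tri> _ _ gt   = contradiction (sym eq) (<⇒≢ (≤-trans (slot-below i′< gt) (m≤m+n (2 ^ r) i)))

pigeonhole-ℕ : ∀ {k n} → k < n → (f : ∀ i → i < n → ℕ) → (∀ i (lt : i < n) → f i lt < k) →
               ∃₂ λ i j → Σ (i < n) λ li → Σ (j < n) λ lj → i < j × f i li ≡ f j lj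
pigeonhole-ℕ {k} {n} k<n f f< with F.pigeonhole k<n (λ i → fromℕ< (f< (toℕ i) (F.toℕ<n i)))
... | i , j , i<j , eq = toℕ i , toℕ j , F.toℕ<n i , F.toℕ<n j , i<j ,
  trans (sym (F.toℕ-fromℕ< _)) (trans (cong toℕ eq) (F.toℕ-fromℕ< _))

-- The requirements below `q` have at most `1 + 2 + ... + 2 ^ (q ∸ 1)` candidates together, one
-- fewer than the numbers `s l`.
candidates-few : ∀ m q ys (s : ℕ → ℕ) → (∀ i j → i < j → j < 2 ^ q → s i ≢ s j) →
                 ¬ (∀ l → l < 2 ^ q → ∃ λ r → r < q × Candidate m r (s l) ys)
candidates-few m q ys s inj c = clash (pigeonhole-ℕ k<n f f<)
  where
  f : ∀ l → l < 2 ^ q → ℕ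
  f l lt = let r , _ , _ , _ , _ , _ , i , _ = c l lt in pred (2 ^ r + i)
  positive : ∀ r i → NonZero (2 ^ r + i)
  positive r i = >-nonZero (≤-trans (m^n>0 2 r) (m≤m+n (2 ^ r) i))
  k<n : pred (2 ^ q) < 2 ^ q
  k<n = ≤-reflexive (suc-pred (2 ^ q) {{>-nonZero (m^n>0 2 q)}})
  f< : ∀ l lt → f l lt < pred (2 ^ q)
  f< l lt = let r , r<q , _ , _ , _ , _ , i , i< , _ = c l lt in
    <-pred-pred (>-nonZero⁻¹ (2 ^ r + i) {{positive r i}}) (slot-below i< r<q)
    where
    <-pred-pred : ∀ {a b} → 0 < a → a < b → pred a < pred b
    <-pred-pred {suc a} {suc b} _ (s≤s lt) = lt
  clash : ¬ (∃₂ λ i j → Σ (i < 2 ^ q) λ li → Σ (j < 2 ^ q) λ lj → i < j × f i li ≡ f j lj)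
  clash (l , l′ , lt , lt′ , l<l′ , eq)
    with c l lt | c l′ lt′
  ... | r , _ , d , _ , g , n , i , i< , x≡ | r′ , _ , d′ , _ , g′ , n′ , i′ , i′< , x≡′
    with refl , refl ← slot-injective {r} {i} {r′} {i′} i< i′< (pred-injective {{positive r i}} {{positive r′ i′}} eq)
    -- Both numbers now stand at position `i` of the least good list for `r`, and that list is
    -- unique.
    with <-cmp d d′
  ... | tri< lt₁ _ _  = n′ d lt₁ g
  ... | tri> _ _ lt₁  = n d′ lt₁ g′
  ... | tri≈ _ refl _ = inj l l′ l<l′ lt′ (trans x≡ (sym x≡′))

iter-shift : ∀ (f : ℕ → ℕ) i x → iter f (suc i) x ≡ iter f i (f x)
iter-shift f zero    x = refl
iter-shift f (suc i) x = cong f (iter-shift f i x)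

list-code : ∀ N (s : ℕ → ℕ) → ∃ λ d → ∀ i → i < N → nth d i ≡ s i
list-code zero    s = 0 , λ _ ()
list-code (suc N) s with list-code N (s ∘ suc)
... | d , h = pair (s 0) d , λ where
  zero    _        → π₁-pair (s 0) d
  (suc i) (s≤s lt) → trans (cong π₁ (trans (iter-shift π₂ i (pair (s 0) d)) (cong (iter π₂ i) (π₂-pair (s 0) d)))) (h i lt)

least : ∀ {P : ℕ → Set} n → P n → ¬ ¬ ∃ λ k → P k × (∀ j → j < k → ¬ P j)
least {P} n p k = go n n ≤-refl p
  where
  go : ∀ b n → n ≤ b → ¬ P n
  go zero    zero le p = k (0 , p , λ _ ())
  go (suc b) n    le p = k (n , p , λ j lt → go b j (≤-pred (≤-trans lt le)))

bounded-above : ∀ N (s : ℕ → ℕ) → ∃ λ b → ∀ i → i < N → s i ≤ b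
bounded-above zero    s = 0 , λ _ ()
bounded-above (suc N) s with bounded-above N s
... | b , h = b ⊔ s N , λ i lt → case m<1+n⇒m<n∨m≡n lt of λ where
  (inj₁ l)    → ≤-trans (h i l) (m≤m⊔n b (s N))
  (inj₂ refl) → m≤n⊔m b (s N)

module _ {m : ℕ} (σ : ∀ q → ∃ (AllSettles m q)) where

  -- The bound from `σ` makes the search for `a` finite, so decidability climbs from each level
  -- below `m` to the next.
  L? : ∀ d → d ≤ m → ∀ e v → Dec (L d e v)
  L-search : ∀ d → d < m → ∀ e v → (∃ λ a → L d e (pair v a)) ⊎ L (suc d) e v

  L? zero    _  e v = dec (dec-L₀ (comp-const e) (comp-const v)) 0
  L? (suc d) lt e v with L-search d lt e v
  ... | inj₁ (a , l) = no λ n → n a l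
  ... | inj₂ l       = yes l

  L-search d lt e v with σ (suc (e ⊔ v))
  ... | x , s with search< (λ a → L? d (<⇒≤ lt) e (pair v a)) x
  ... | inj₁ (a , _ , l) = inj₁ (a , l)
  ... | inj₂ none        = inj₂ (s d lt e (s≤s (m≤m⊔n e v)) v (s≤s (m≤n⊔m e v)) none)

  markov : Markov m
  markov d lt e v n with L-search d lt e v
  ... | inj₁ w = w
  ... | inj₂ l = contradiction l n

module Avoidance
  (m : ℕ) (h : ℕ → ℕ) (h-mono : ∀ {x y} → x ≤ y → h x ≤ h y)
  (A : ℕ → Set) (unbounded : ∀ N → ∃ λ x → A x × N ≤ h x)
  where

  -- Together with its starting point, such a vector is a set whose elements lie in different
  -- blocks; these are the sets that `Low` colours.
  Chain : ∀ n → ℕ → Vec ℕ n → Set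
  Chain zero    b ys = ⊤
  Chain (suc n) b ys = h b < h (lookup ys F.zero) × A (lookup ys F.zero) × Chain n (lookup ys F.zero) (V.tail ys)

  h-cancel : ∀ {x y} → h x < h y → x < y
  h-cancel {x} {y} lt = ≰⇒> λ le → <⇒≱ lt (h-mono le)

  beyond : ∀ b N → ∃ λ y → A y × h b < h y × N ≤ y
  beyond b N with unbounded (suc (h b ⊔ h N))
  ... | y , a , le = y , a , ≤-trans (s≤s (m≤m⊔n (h b) (h N))) le ,
    <⇒≤ (h-cancel (≤-trans (s≤s (m≤n⊔m (h b) (h N))) le))

  chain-weaken : ∀ n {b b′} ys → b′ ≤ b → Chain n b ys → Chain n b′ ys
  chain-weaken zero    ys le c            = tt
  chain-weaken (suc n) ys le (lt , a , c) = ≤-trans (s≤s (h-mono le)) lt , a , c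

  -- `A` has elements in blocks beyond every threshold, so the thresholds of `Ev` can be met one
  -- entry at a time.
  pick : ∀ n {P : Vec ℕ n → Set} b → Ev n P → ¬ ¬ ∃ λ ys → Chain n b ys × P ys
  pick n b e = go n b (far e)
    where
    go : ∀ n {P : Vec ℕ n → Set} b → Far n P → ¬ ¬ ∃ λ ys → Chain n b ys × P ys
    go zero    b f k = f λ p → k ([] , tt , p)
    go (suc n) b f k = f λ (t , g) → let y , a , lt , t≤y = beyond b t in
      go n y (g y t≤y) λ (ys , c , p) → k (y ∷ ys , (lt , a , c) , p)

  enum : ℕ → ℕ → ∃ A
  enum b zero    = let y , a , _ = beyond b b in y , a
  enum b (suc n) = let y , a , _ = beyond (proj₁ (enum b n)) 0 in y , a

  enum-step : ∀ b n → proj₁ (enum b n) < proj₁ (enum b (suc n))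
  enum-step b n = let _ , _ , lt , _ = beyond (proj₁ (enum b n)) 0 in h-cancel lt

  enum-mono : ∀ b {i j} → i < j → proj₁ (enum b i) < proj₁ (enum b j)
  enum-mono b {i} {suc j} lt with m<1+n⇒m<n∨m≡n lt
  ... | inj₁ l    = <-trans (enum-mono b l) (enum-step b j)
  ... | inj₂ refl = enum-step b j

  enum-≥ : ∀ b i → b ≤ proj₁ (enum b i)
  enum-≥ b zero    = let _ , _ , _ , le = beyond b b in le
  enum-≥ b (suc i) = <⇒≤ (≤-trans (s≤s (enum-≥ b i)) (enum-step b i))

  Never Always : Set
  Never  = ∀ x ys → A x → Chain (suc m) x ys → ¬ Low m x ys
  Always = ∀ x ys → A x → Chain (suc m) x ys → Low m x ys

  -- Take elements `x < y` of `A` with `q ≤ x`. If `y` did not settle the codes below `x`, distant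
  -- bounds from `A` would make the set unstable, hence `Low`.
  settle-never : Never → ∀ q → ∃ (AllSettles m q)
  settle-never never q with beyond 0 q
  ... | x , x∈ , _ , q≤x with beyond x 0
  ... | y , y∈ , x<y , _ = y , allSettles-¬¬ λ k → pick m y (stable⇒settles m x y) λ (ys , c , f) →
    never x (y ∷ ys) x∈ (x<y , y∈ , c) (inj₁ λ s → k (allSettles-mono q≤x ≤-refl (f s)))

  -- Suppose `X` does not settle `q`; then no smaller number does. Far out, the `2 ^ q` elements
  -- `s l` are stable, so they are `Low` by being candidates. Candidates for any `r ≥ q` would
  -- settle `q`, so all of them belong to requirements below `q`, which is too many.
  settle-always : Always → ∀ q → ∃ (AllSettles m q)
  settle-always always q = X , allSettles-¬¬ λ k →
    pick (suc m) X
      (ev-zip (suc m) (λ _ → _,_)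
        (ev-∀< (suc m) (2 ^ q) λ l _ → stable-eventually m (s l))
        (ev-tail m (ev-∀< m (2 ^ q) λ l _ → stable⇒settles m q (s l))))
    λ (ys , c , stable , settles) →
    candidates-few m q ys s (λ i j i<j _ → <⇒≢ (enum-mono 0 i<j)) λ l lt →
    case always (s l) ys (proj₂ (enum 0 l)) (chain-weaken (suc m) ys (<⇒≤ (enum-mono 0 lt)) c) of λ where
      (inj₁ unstable)                     → contradiction (stable l lt) unstable
      (inj₂ (r , _ , _ , cand , _)) → r , ≰⇒> (λ q≤r →
        k (allSettles-mono ≤-refl (<⇒≤ (enum-mono 0 lt)) (settles l lt (stable-mono m {ys = V.tail ys} q≤r (stable-of {ys = ys} cand))))) , cand
    where
    s : ℕ → ℕ
    s l = proj₁ (enum 0 l)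
    X : ℕ
    X = s (2 ^ q)
    stable-of : ∀ {r x ys} → Candidate m r x ys → Stable m r x (V.tail ys)
    stable-of (d , _ , g , _ , i , i< , refl) = proj₁ (proj₂ (g i i<))

  module Diagonal (σ : ∀ q → ∃ (AllSettles m q)) (r : ℕ)
    (index : ∀ x → A x → ∃ λ a → L (suc m) (π₁ r) (pair x a))
    (index⁻¹ : ∀ x a → L (suc m) (π₁ r) (pair x a) → A x)
    where

    good : ∃ (GoodL m r)
    good = d , λ i lt →
      subst (L (suc m) (π₁ r)) (sym (d≡ i lt)) (proj₂ (index (s i) (proj₂ (enum X i)))) ,
      subst (AllSettles m r) (sym (x≡ i lt)) (allSettles-mono ≤-refl (enum-≥ X i) (proj₂ (σ r))) ,
      λ j j<i eq → <⇒≢ (enum-mono X j<i) (trans (sym (x≡ j (<-trans j<i lt))) (trans eq (x≡ i lt)))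
      where
      X : ℕ
      X = proj₁ (σ r)
      s : ℕ → ℕ
      s i = proj₁ (enum X i)
      code-of : ∃ λ d → ∀ i → i < 2 ^ r → nth d i ≡ pair (s i) (proj₁ (index (s i) (proj₂ (enum X i))))
      code-of = list-code (2 ^ r) λ i → pair (s i) (proj₁ (index (s i) (proj₂ (enum X i))))
      d : ℕ
      d = proj₁ code-of
      d≡ : ∀ i → i < 2 ^ r → nth d i ≡ pair (s i) (proj₁ (index (s i) (proj₂ (enum X i))))
      d≡ = proj₂ code-of
      x≡ : ∀ i → i < 2 ^ r → π₁ (nth d i) ≡ s i
      x≡ i lt = trans (cong π₁ (d≡ i lt)) (π₁-pair (s i) _)

    -- Far out, the least list `d` satisfying `GoodL` is also the least satisfying `Good`, and its
    -- `2 ^ r` entries are candidates. Smaller requirements cannot claim all of them, by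
    -- `candidates-few`. The list need not be the one in `good`, so membership in `A` comes from
    -- `index⁻¹`.
    marked : ¬ ¬ ∃₂ λ x ys → A x × Chain (suc m) x ys × r < lookup ys F.zero ×
             Stable m x (lookup ys F.zero) (V.tail ys) × Marker m r x ys
    marked k = least (proj₁ good) (proj₂ good) λ (d , gd , min) →
      let s = λ i → π₁ (nth d i)
          b , s≤b = bounded-above (2 ^ r) s in
      pick (suc m) b
        (ev-zip (suc m) (λ _ → _,_)
          (ev-zip (suc m) (λ _ → _,_)
            (ev-∀< (suc m) (suc d) λ d′ _ → Good⇔GoodL m r d′)
            (ev-∀< (suc m) (2 ^ r) λ i _ → stable-eventually m (s i)))
          (ev-∷ m {P = λ ys → suc (d ⊔ r) ≤ lookup ys F.zero} λ k → k (suc (d ⊔ r) , λ y le → ev-pure m λ _ → le)))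
      λ (ys , c , (good⇔ , stable) , large) →
      let d<y = ≤-trans (s≤s (m≤m⊔n d r)) large
          r<y = ≤-trans (s≤s (m≤n⊔m d r)) large
          candidate : ∀ i → i < 2 ^ r → Candidate m r (s i) ys
          candidate i lt = d , d<y , proj₂ (good⇔ d ≤-refl) gd ,
            (λ d′ d′< g′ → min d′ d′< (proj₁ (good⇔ d′ (m<n⇒m<1+n d′<)) g′)) , i , lt , refl
      in candidates-few m r ys s (λ i j i<j lt → proj₂ (proj₂ (gd j lt)) i i<j) λ l lt →
         case search< (λ r′ → candidate? m r′ (s l) ys) r of λ where
           (inj₁ found) → found
           (inj₂ none)  → contradiction
             (s l , ys , index⁻¹ (s l) (π₂ (nth d l)) (subst (L (suc m) (π₁ r)) (sym (pair-unpair (nth d l))) (proj₁ (gd l lt))) ,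
              chain-weaken (suc m) ys (s≤b l lt) c , r<y , stable l lt , candidate l lt , none) k

  module _ {e : ℕ}
    (index : ∀ x → A x → ∃ λ a → L (suc m) e (pair x a))
    (index⁻¹ : Markov m → ∀ x a → L (suc m) e (pair x a) → A x)
    where

    marked : (σ : ∀ q → ∃ (AllSettles m q)) (c : ℕ) →
      ¬ ¬ ∃₂ λ x ys → A x × Chain (suc m) x ys × pair e c < lookup ys F.zero ×
        Stable m x (lookup ys F.zero) (V.tail ys) × Marker m (pair e c) x ys
    marked σ c = Diagonal.marked σ (pair e c)
      (λ x x∈ → let a , l = index x x∈ in a , subst (λ e → L (suc m) e (pair x a)) (sym (π₁-pair e c)) l)
      (λ x a l → index⁻¹ (markov σ) x a (subst (λ e → L (suc m) e (pair x a)) (π₁-pair e c) l))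

    ¬never : ¬ Never
    ¬never never = marked (settle-never never) 0 λ (x , ys , x∈ , c , r< , _ , mk) →
      never x ys x∈ c (inj₂ (pair e 0 , r< , π₂-pair e 0 , mk))

    -- The requirement `pair e 1` has a stable marker. By uniqueness no requirement asking for `Low`
    -- marks it, so neither alternative of `Low` holds.
    ¬always : ¬ Always
    ¬always always = marked (settle-always always) 1 λ (x , ys , x∈ , c , r< , stable , mk) →
      case always x ys x∈ c of λ where
        (inj₁ unstable)            → unstable stable
        (inj₂ (r , _ , r≡0 , mk′)) →
          1+n≢0 (trans (sym (π₂-pair e 1)) (trans (cong π₂ (marker-unique m {ys = ys} mk mk′)) r≡0))

-- Finite Ramsey theorem

Inc : List ℕ → Set
Inc []       = ⊤
Inc (x ∷ xs) = (∀ {y} → y ∈ˡ xs → x < y) × Inc xs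

_⊆ˡ_ : List ℕ → List ℕ → Set
H ⊆ˡ X = ∀ {y} → y ∈ˡ H → y ∈ˡ X

linked⇒inc : ∀ {xs} → Linked _<_ xs → Inc xs
linked⇒inc []       = tt
linked⇒inc [-]      = (λ ()) , tt
linked⇒inc (lt ∷ l) with linked⇒inc l
... | below , inc = (λ { (here refl) → lt ; (there i) → <-trans lt (below i) }) , below , inc

increasing-∷ : ∀ {m x} {v : Vec ℕ m} → All (x <_) v → Increasing v → Increasing (x ∷ v)
increasing-∷ []        _ = [-]
increasing-∷ (lt ∷ _)  l = lt ∷ l

increasing-tail : ∀ {m x} {v : Vec ℕ m} → Increasing (x ∷ v) → Increasing v
increasing-tail {v = []}    _       = []
increasing-tail {v = y ∷ v} (_ ∷ l) = l

increasing-head : ∀ {m x} {v : Vec ℕ m} → Increasing (x ∷ v) → All (x <_) v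
increasing-head {v = []}    _        = []
increasing-head {v = y ∷ v} (lt ∷ l) = lt ∷ All.map (<-trans lt) (increasing-head l)

initial-segment : ∀ m H → m ≤ length H → Inc H → Σ (Vec ℕ m) λ v → Increasing v × All (_∈ˡ H) v
initial-segment zero    H       le inc = [] , [] , []
initial-segment (suc m) (x ∷ H) (s≤s le) (below , inc) with initial-segment m H le inc
... | v , l , v⊆ = x ∷ v , increasing-∷ (All.map below v⊆) l , here refl ∷ All.map there v⊆

data Split (κ : ℕ → ℕ) (c : ℕ) (P : List ℕ) : Set where
  split : ∀ S T → S ⊆ˡ P → T ⊆ˡ P → (∀ {y} → y ∈ˡ S → κ y ≡ c) → (∀ {y} → y ∈ˡ T → κ y ≢ c) →
          length S + length T ≡ length P → Inc S → Inc T → Split κ c P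

split-by : ∀ κ c P → Inc P → Split κ c P
split-by κ c []      _ = split [] [] id id (λ ()) (λ ()) refl tt tt
split-by κ c (x ∷ P) (below , inc) with split-by κ c P inc
... | split S T S⊆ T⊆ S≡ T≢ len incS incT with κ x ≟ c
... | yes e = split (x ∷ S) T (λ { (here refl) → here refl ; (there i) → there (S⊆ i) }) (there ∘ T⊆)
                (λ { (here refl) → e ; (there i) → S≡ i }) T≢ (cong suc len) (below ∘ S⊆ , incS) incT
... | no n  = split S (x ∷ T) (there ∘ S⊆) (λ { (here refl) → here refl ; (there i) → there (T⊆ i) })
                S≡ (λ { (here refl) → n ; (there i) → T≢ i }) (trans (+-suc _ _) (cong suc len)) incS (below ∘ T⊆ , incT)

monochromatic : ∀ κ c m P → Inc P → (∀ {y} → y ∈ˡ P → κ y < c) → c * m < length P →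
  ∃₂ λ H j → m ≤ length H × H ⊆ˡ P × Inc H × (∀ {y} → y ∈ˡ H → κ y ≡ j)
monochromatic κ zero    m []      inc κ< ()
monochromatic κ zero    m (x ∷ P) inc κ< _ = contradiction (κ< (here refl)) λ ()
monochromatic κ (suc c) m P inc κ< lt with split-by κ c P inc
... | split S T S⊆ T⊆ S≡ T≢ len incS incT with m ≤? length S
... | yes le = S , c , le , S⊆ , incS , S≡
... | no gt  with monochromatic κ c m T incT (λ i → ≤∧≢⇒< (≤-pred (κ< (T⊆ i))) (T≢ i)) c*m<
  where
  c*m< : c * m < length T
  c*m< = +-cancelˡ-< m _ _ (<-≤-trans (subst (m + c * m <_) (sym len) lt) (+-monoˡ-≤ (length T) (<⇒≤ (≰⇒> gt))))
... | H , j , le , H⊆ , incH , κ≡ = H , j , le , T⊆ ∘ H⊆ , incH , κ≡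

-- The length from which `t` end-homogeneous elements can be extracted: each step sets one element
-- aside and thins out the rest by `f`.
grow : (ℕ → ℕ) → ℕ → ℕ
grow f t = iter (λ y → suc (f y)) t 0

-- Among `suc (c * m)` end-homogeneous elements, `m` force the same colour. Any computable bound
-- will do, since the blocks may be as long as needed.
ramsey : ℕ → ℕ → ℕ → ℕ
ramsey c zero    m = m
ramsey c (suc n) m = grow (ramsey c n) (suc (c * m))

comp-ramsey : ∀ c n {u} → Comp u → Comp (λ z → ramsey c n (u z))
comp-ramsey c zero    cu = cu
comp-ramsey c (suc n) cu =
  comp-iter {λ _ y → suc (ramsey c n y)} (comp-suc (comp-ramsey c n (comp-π₂ comp-id)))
    (comp-suc (comp-* (comp-const c) cu)) (comp-const 0)

Monochrome : ∀ {n c} → (Vec ℕ n → Fin c) → List ℕ → Fin c → Set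
Monochrome g H j = ∀ s → Increasing s → All (_∈ˡ H) s → g s ≡ j

RamseyFor : ℕ → ℕ → Set
RamseyFor c n = ∀ m X → Inc X → ramsey c n m ≤ length X → (g : Vec ℕ n → Fin c) →
  ∃ λ H → m ≤ length H × H ⊆ˡ X × Inc H × ∃ (Monochrome g H)

-- The colour is made to depend on the least element only: after `x`, the induction hypothesis thins
-- the rest until `g (x ∷ s)` is constant.
end-homogeneous : ∀ {c n} → RamseyFor c n → ∀ t X → Inc X → grow (ramsey c n) t ≤ length X → (g : Vec ℕ (suc n) → Fin c) →
  Fin c → ∃ λ P → t ≤ length P × P ⊆ˡ X × Inc P ×
    Σ (ℕ → Fin c) λ κ → ∀ y s → Increasing (y ∷ s) → All (_∈ˡ P) (y ∷ s) → g (y ∷ s) ≡ κ y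
-- `j₀` is a default value for `κ` outside the extracted set.
end-homogeneous ih zero    X       inc le g j₀ = [] , z≤n , (λ ()) , tt , (λ _ → j₀) , λ { y s l (() ∷ _) }
end-homogeneous {c} {n} ih (suc t) (x ∷ X) (below , inc) (s≤s le) g j₀
  with ih (grow (ramsey c n) t) X inc le (λ s → g (x ∷ s))
... | H , leH , H⊆ , incH , j , mono with end-homogeneous ih t H incH leH g j₀
... | P , leP , P⊆ , incP , κ , ends =
  x ∷ P , s≤s leP , (λ { (here refl) → here refl ; (there i) → there (H⊆ (P⊆ i)) }) , (below ∘ H⊆ ∘ P⊆ , incP) , κ′ , ends′
  where
  κ′ : ℕ → Fin c
  κ′ y with y ≟ x
  ... | yes _ = j
  ... | no _  = κ y
  later : ∀ {y k} {s : Vec ℕ k} → x ≤ y → All (y <_) s → All (_∈ˡ (x ∷ P)) s → All (_∈ˡ P) s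
  later le []         []              = []
  later le (lt ∷ lts) (here refl ∷ _) = contradiction lt (≤⇒≯ le)
  later le (_ ∷ lts)  (there i ∷ is)  = i ∷ later le lts is
  ends′ : ∀ y s → Increasing (y ∷ s) → All (_∈ˡ (x ∷ P)) (y ∷ s) → g (y ∷ s) ≡ κ′ y
  ends′ y s l (y∈ ∷ s∈) with y ≟ x
  ... | yes refl = mono s (increasing-tail l) (All.map P⊆ (later ≤-refl (increasing-head l) s∈))
  ends′ y s l (here refl ∷ s∈) | no n = contradiction refl n
  ends′ y s l (there i ∷ s∈)   | no n = ends y s l (i ∷ later (<⇒≤ (below (H⊆ (P⊆ i)))) (increasing-head l) s∈)

finite-ramsey : ∀ k n → RamseyFor (suc k) n
finite-ramsey k zero    m X inc le g = X , le , id , inc , g [] , λ { [] _ _ → refl }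
finite-ramsey k (suc n) m X inc le g
  with end-homogeneous (finite-ramsey k n) (suc (suc k * m)) X inc le g F.zero
... | P , leP , P⊆ , incP , κ , ends
  with monochromatic (toℕ ∘ κ) (suc k) m P incP (λ _ → F.toℕ<n _) leP
... | [] , j , leH , H⊆ , incH , κ≡ = [] , leH , P⊆ ∘ H⊆ , incH , F.zero , λ { (_ ∷ _) _ (() ∷ _) }
... | z ∷ H , j , leH , H⊆ , incH , κ≡ = z ∷ H , leH , P⊆ ∘ H⊆ , incH , κ z , λ where
  (y ∷ s) l (y∈ ∷ s∈) → trans (ends y s l (All.map H⊆ (y∈ ∷ s∈)))
                              (F.toℕ-injective (trans (κ≡ y∈) (sym (κ≡ (here refl)))))

arrow : ∀ k n m w → ramsey (suc k) n m ≤ w → Arrow w m n (suc k)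
arrow k n m w le X inc g with finite-ramsey k n m (toList X) (linked⇒inc inc) (subst (_ ≤_) (sym (length-toList X)) le) g
... | H , leH , H⊆ , incH , j , mono with initial-segment m H leH incH
... | v , l , v⊆ = v , l , All.map (∈-toList⁻ ∘ H⊆) v⊆ , j , λ s ls s∈ → mono s ls (All.map (All.lookup v⊆) s∈)

-- Blocks and packed sets

-- A slow inverse of `R`: the value `j` rises by one when the argument has reached `R (suc j)`.
-- Truncated subtraction performs the test.
block : (ℕ → ℕ) → ℕ → ℕ
block R = natrec (λ i j → j + (1 ∸ (R (suc j) ∸ suc i))) 0

module Blocks (R : ℕ → ℕ) where

  step-up : ∀ {i j} → R (suc j) ≤ suc i → j + (1 ∸ (R (suc j) ∸ suc i)) ≡ suc j
  step-up {i} {j} le = trans (cong (λ k → j + (1 ∸ k)) (m≤n⇒m∸n≡0 le)) (+-comm j 1)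

  step-stay : ∀ {i j} → ¬ R (suc j) ≤ suc i → j + (1 ∸ (R (suc j) ∸ suc i)) ≡ j
  step-stay {i} {j} gt = trans (cong (j +_) (m≤n⇒m∸n≡0 (m<n⇒0<n∸m (≰⇒> gt)))) (+-identityʳ j)

  block-bound : ∀ w → block R w ≡ 0 ⊎ R (block R w) ≤ w
  block-bound zero = inj₁ refl
  block-bound (suc w) with R (suc (block R w)) ≤? suc w
  ... | yes le rewrite step-up le = inj₂ le
  ... | no gt rewrite step-stay gt = Data.Sum.map₂ (λ le → ≤-trans le (n≤1+n w)) (block-bound w)

  block-mono : ∀ {x y} → x ≤ y → block R x ≤ block R y
  block-mono le = go (≤⇒≤′ le)
    where
    go : ∀ {x y} → x ≤′ y → block R x ≤ block R y
    go ≤′-refl     = ≤-refl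
    go (≤′-step p) = ≤-trans (go p) (m≤m+n _ _)

  -- If `suc M` is not yet reached at `N ⊔ R (suc M)`, the value there is exactly `M`, and the test
  -- succeeds in the next step.
  block-unbounded : ∀ M → ∃ λ N → M ≤ block R N
  block-unbounded zero = 0 , z≤n
  block-unbounded (suc M) with block-unbounded M
  ... | N , le with suc M ≤? block R (N ⊔ R (suc M))
  ... | yes lt = N ⊔ R (suc M) , lt
  ... | no ge  = suc (N ⊔ R (suc M)) , ≤-reflexive (sym up)
    where
    eq : block R (N ⊔ R (suc M)) ≡ M
    eq = ≤-antisym (≤-pred (≰⇒> ge)) (≤-trans le (block-mono (m≤m⊔n N (R (suc M)))))
    up : block R (suc (N ⊔ R (suc M))) ≡ suc M
    up rewrite eq = step-up (≤-trans (m≤n⊔m N (R (suc M))) (n≤1+n _))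

  block-reach : ∀ N → ∃ λ X → ∀ {y} → X ≤ y → N ≤ block R y
  block-reach N = let X , le = block-unbounded N in X , λ X≤y → ≤-trans le (block-mono X≤y)

  comp-block : (∀ {u} → Comp u → Comp (λ z → R (u z))) → ∀ {u} → Comp u → Comp (λ z → block R (u z))
  comp-block cR cu = comp-natrec {λ _ i j → j + (1 ∸ (R (suc j) ∸ suc i))}
    (comp-+ acc (comp-∸ (comp-const 1) (comp-∸ (cR (comp-suc acc)) (comp-suc (comp-π₁ (comp-π₂ comp-id))))))
    cu (comp-const 0)
    where
    acc : Comp (λ w → π₂ (π₂ w))
    acc = comp-π₂ (comp-π₂ comp-id)

halve : ∀ t → ∃₂ λ b t′ → t ≡ b + 2 * t′ × (b ≡ 0 ⊎ b ≡ 1)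
halve zero    = 0 , 0 , refl , inj₁ refl
halve (suc t) with halve t
... | _ , t′ , eq , inj₁ refl = 1 , t′ , cong suc eq , inj₂ refl
... | _ , t′ , eq , inj₂ refl = 0 , suc t′ , trans (cong suc eq) (sym (*-suc 2 t′)) , inj₁ refl

module Joins (h : ℕ → ℕ) where

  same : ℕ → ℕ → ℕ
  same x y = 1 ∸ ((h x ∸ h y) + (h y ∸ h x))

  same-≡ : ∀ {x y} → h x ≡ h y → same x y ≡ 1
  same-≡ {x} {y} eq rewrite eq | n∸n≡0 (h y) = refl

  same-< : ∀ {x y} → h x < h y → same x y ≡ 0
  same-< {x} {y} lt = m≤n⇒m∸n≡0 (≤-trans (m<n⇒0<n∸m lt) (m≤n+m (h y ∸ h x) (h x ∸ h y)))

  same-≤1 : ∀ x y → same x y ≤ 1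
  same-≤1 x y = m∸n≤m 1 ((h x ∸ h y) + (h y ∸ h x))

  -- The binary digits record which neighbouring entries of s lie in the same block.
  joins : ∀ p → Vec ℕ (suc p) → ℕ
  joins zero    s = 0
  joins (suc p) s = same (lookup s F.zero) (lookup s (F.suc F.zero)) + 2 * joins p (V.tail s)

  joins-< : ∀ p s → joins p s < 2 ^ p
  joins-< zero    s = s≤s z≤n
  joins-< (suc p) s = begin-strict
    same (lookup s F.zero) (lookup s (F.suc F.zero)) + 2 * joins p (V.tail s)
      ≤⟨ +-monoˡ-≤ _ (same-≤1 (lookup s F.zero) (lookup s (F.suc F.zero))) ⟩
    1 + 2 * joins p (V.tail s)       <⟨ n<1+n _ ⟩
    2 + 2 * joins p (V.tail s)       ≡⟨ sym (*-suc 2 (joins p (V.tail s))) ⟩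
    2 * suc (joins p (V.tail s))     ≤⟨ *-monoʳ-≤ 2 (joins-< p (V.tail s)) ⟩
    2 * 2 ^ p                           ∎
    where open ≤-Reasoning

  comp-joins : (∀ {u} → Comp u → Comp (λ z → h (u z))) → ∀ p {s : ℕ → Vec ℕ (suc p)} → CompV s → Comp (λ w → joins p (s w))
  comp-joins ch zero    cs = comp-const 0
  comp-joins ch (suc p) cs = comp-+
    (comp-∸ (comp-const 1) (comp-+ (comp-∸ cx cy) (comp-∸ cy cx)))
    (comp-* (comp-const 2) (comp-joins ch p (compV-tail cs)))
    where
    cx = ch (entry cs F.zero)
    cy = ch (entry cs (F.suc F.zero))

drop-≥ : ∀ k b l → Inc l → (∀ {y} → y ∈ˡ l → b ≤ y) →
         ∃ λ l′ → Inc l′ × l′ ⊆ˡ l × (∀ {y} → y ∈ˡ l′ → b + k ≤ y) × length l ≤ k + length l′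
drop-≥ zero    b l       inc b≤ = l , inc , id , (λ i → ≤-trans (≤-reflexive (+-identityʳ b)) (b≤ i)) , ≤-refl
drop-≥ (suc k) b []      inc b≤ = [] , tt , id , (λ ()) , z≤n
drop-≥ (suc k) b (x ∷ l) (below , inc) b≤
  with drop-≥ k (suc b) l inc (λ i → ≤-trans (s≤s (b≤ (here refl))) (below i))
... | l′ , inc′ , l′⊆ , ≤y , len =
  l′ , inc′ , there ∘ l′⊆ , (λ i → ≤-trans (≤-reflexive (+-suc b k)) (≤y i)) , s≤s len

-- Pigeonhole over `V` consecutive blocks: either the block `a` has `suc q` elements of the list, or
-- discarding it costs at most `q`.
find-run : ∀ (h : ℕ → ℕ) q V a l → Inc l → (∀ {y} → y ∈ˡ l → a ≤ h y × h y < a + V) → q * V < length l →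
  ∃ λ j → a ≤ j × Σ (Vec ℕ (suc q)) λ v → Increasing v × All (λ y → y ∈ˡ l × h y ≡ j) v
find-run h q zero    a []      inc range lt = contradiction lt λ ()
find-run h q zero    a (x ∷ l) inc range lt with range (here refl)
... | a≤ , <a = contradiction (≤-<-trans a≤ (subst (h x <_) (+-identityʳ a) <a)) (<-irrefl refl)
find-run h q (suc V) a l inc range lt with split-by h a l inc
... | split S T S⊆ T⊆ S≡ T≢ len incS incT with suc q ≤? length S
... | yes le with initial-segment (suc q) S le incS
... | v , iv , v⊆ = a , ≤-refl , v , iv , All.map (λ i → S⊆ i , S≡ i) v⊆
find-run h q (suc V) a l inc range lt | split S T S⊆ T⊆ S≡ T≢ len incS incT | no gt
  with find-run h q V (suc a) T incT
    (λ {y} i → let a≤ , <a = range (T⊆ i) in ≤∧≢⇒< a≤ (T≢ i ∘ sym) , subst (h y <_) (+-suc a V) <a) qV<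
  where
  qV< : q * V < length T
  qV< = +-cancelˡ-< q _ _ (<-≤-trans (subst₂ _<_ (*-suc q V) (sym len) lt) (+-monoˡ-≤ (length T) (≤-pred (≰⇒> gt))))
... | j , a<j , v , iv , v⊆ = j , <⇒≤ a<j , v , iv , All.map (λ (i , e) → T⊆ i , e) v⊆

∈-index-injective : ∀ {N k} {C : Vec (Fin k) N} {x y} (i : x ∈ C) (j : y ∈ C) → AnyV.index i ≡ AnyV.index j → x ≡ y
∈-index-injective {C = C} i j eq = trans (lookup-index i) (trans (cong (lookup C) eq) (sym (lookup-index j)))

too-many-colours : ∀ {N k} (C : Vec (Fin k) N) (c : Fin (suc N) → Fin k) → (∀ i j → c i ≡ c j → i ≡ j) → ¬ (∀ i → c i ∈ C)
too-many-colours C c inj c∈ with F.pigeonhole ≤-refl (λ i → AnyV.index (c∈ i))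
... | i , j , i<j , eq = F.<⇒≢ i<j (inj i j (∈-index-injective (c∈ i) (c∈ j) eq))

-- The colouring and the packing function

module Construction (m k : ℕ) (k> : 2 ^ suc m < k)
  (h : ℕ → ℕ)
  (h-mono : ∀ {x y} → x ≤ y → h x ≤ h y)
  (h-reach : ∀ N → ∃ λ X → ∀ {y} → X ≤ y → N ≤ h y)
  (comp-h : ∀ {u} → Comp u → Comp (λ z → h (u z)))
  where

  open Joins h

  n : ℕ
  n = suc (suc m)

  φ : ℕ → ℕ
  φ w = n * h w

  φ-computable : ComputableFun φ
  φ-computable = graphF (proj₁ c) 1 , graphF-Σ₁ (proj₁ c) 1 , λ w y →
    subst (λ z → Sat (graphF (proj₁ c) 1) (y ∷ w ∷ []) ⇔ (n * h z ≡ y)) (π₂-pair 0 w) (graphF-correct c (w ∷ []) y)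
    where
    c : Comp (λ z → n * h (π₂ z))
    c = comp-* (comp-const n) (comp-h (comp-π₂ comp-id))

  φ-liminf : LiminfInfinite φ
  φ-liminf M with h-reach M
  ... | N , reach = N , λ w le → ≤-trans (reach le) (m≤m+n (h w) (suc m * h w))

  abstract
    low : DecC (λ w → Low m (π₂ w) (decV (suc m) (π₁ w)))
    low = dec-Low m (comp-π₂ comp-id) (compV-decV (suc m) (comp-π₁ comp-id))

    low? : ∀ x ys → Dec (Low m x ys)
    low? x ys = dec (dec-Low m (comp-const x) (compV-const ys)) 0

  -- A case distinction in arithmetic: a nonzero pattern `b` of joins is the colour; for `b` zero,
  -- the truth value `l` of `Low` decides.
  mix : ℕ → ℕ → ℕ
  mix b l = b + (1 ∸ b) * ((1 ∸ l) * 2 ^ suc m)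

  mix-joined : ∀ b l → b ≢ 0 → mix b l ≡ b
  mix-joined zero    l b≢0 = contradiction refl b≢0
  mix-joined (suc b) l b≢0 = trans (cong (λ z → suc b + z * ((1 ∸ l) * 2 ^ suc m)) (0∸n≡0 b)) (+-identityʳ (suc b))

  mix-0-0 : mix 0 0 ≡ 2 ^ suc m
  mix-0-0 = trans (*-identityˡ (1 * 2 ^ suc m)) (*-identityˡ (2 ^ suc m))

  -- Sets with two elements in a common block get their joins as colour; the others get 0 or 2 ^ (n ∸ 1), according to Low.
  colour : ℕ → ℕ
  colour w = mix (joins (suc m) (decV n w)) (χ low w)

  comp-colour : Comp colour
  comp-colour = comp-+ cj (comp-* (comp-∸ (comp-const 1) cj) (comp-* (comp-∸ (comp-const 1) (comp low)) (comp-const (2 ^ suc m))))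
    where
    cj : Comp (λ w → joins (suc m) (decV n w))
    cj = comp-joins comp-h (suc m) (compV-decV n comp-id)

  colour-mix : ∀ s → colour (enc s) ≡ mix (joins (suc m) s) (χ low (enc s))
  colour-mix s = cong (λ v → mix (joins (suc m) v) (χ low (enc s))) (decV-enc s)

  colour-joined : ∀ s → joins (suc m) s ≢ 0 → colour (enc s) ≡ joins (suc m) s
  colour-joined s j≢0 = trans (colour-mix s) (mix-joined (joins (suc m) s) (χ low (enc s)) j≢0)

  head≡ : ∀ x (ys : Vec ℕ (suc m)) → π₂ (enc (x ∷ ys)) ≡ x
  head≡ x ys = π₂-pair (enc ys) x

  tail≡ : ∀ x (ys : Vec ℕ (suc m)) → decV (suc m) (π₁ (enc (x ∷ ys))) ≡ ys
  tail≡ x ys = trans (cong (decV (suc m)) (π₁-pair (enc ys) x)) (decV-enc ys)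

  low-enc : ∀ x ys → (Low m x ys × χ low (enc (x ∷ ys)) ≡ 1) ⊎ (¬ Low m x ys × χ low (enc (x ∷ ys)) ≡ 0)
  low-enc x ys = subst₂ (λ x′ ys′ → (Low m x′ ys′ × χ low w ≡ 1) ⊎ (¬ Low m x′ ys′ × χ low w ≡ 0))
    {π₂ w} {x} {decV (suc m) (π₁ w)} {ys} (head≡ x ys) (tail≡ x ys) (spec low w)
    where
    w : ℕ
    w = enc (x ∷ ys)

  colour-low : ∀ x ys → joins (suc m) (x ∷ ys) ≡ 0 → Low m x ys → colour (enc (x ∷ ys)) ≡ 0
  colour-low x ys j≡0 l = trans (colour-mix (x ∷ ys)) (cong₂ mix j≡0 (χ≡1 (low-enc x ys)))
    where
    χ≡1 : (Low m x ys × χ low (enc (x ∷ ys)) ≡ 1) ⊎ (¬ Low m x ys × χ low (enc (x ∷ ys)) ≡ 0) → χ low (enc (x ∷ ys)) ≡ 1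
    χ≡1 (inj₁ (_ , e))  = e
    χ≡1 (inj₂ (¬l , _)) = contradiction l ¬l

  colour-high : ∀ x ys → joins (suc m) (x ∷ ys) ≡ 0 → ¬ Low m x ys → colour (enc (x ∷ ys)) ≡ 2 ^ suc m
  colour-high x ys j≡0 ¬l = trans (colour-mix (x ∷ ys)) (trans (cong₂ mix j≡0 (χ≡0 (low-enc x ys))) mix-0-0)
    where
    χ≡0 : (Low m x ys × χ low (enc (x ∷ ys)) ≡ 1) ⊎ (¬ Low m x ys × χ low (enc (x ∷ ys)) ≡ 0) → χ low (enc (x ∷ ys)) ≡ 0
    χ≡0 (inj₁ (l , _)) = contradiction l ¬l
    χ≡0 (inj₂ (_ , e)) = e

  colour-< : ∀ (s : Vec ℕ n) → colour (enc s) < k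
  colour-< s@(x ∷ ys) with joins (suc m) s in eq
  ... | suc _ = ≤-<-trans (≤-reflexive (colour-joined s λ e → case trans (sym eq) e of λ ())) (<-trans (joins-< (suc m) s) k>)
  ... | zero with low? x ys
  ... | yes l = ≤-<-trans (≤-reflexive (colour-low x ys eq l)) (≤-<-trans z≤n k>)
  ... | no ¬l = ≤-<-trans (≤-reflexive (colour-high x ys eq ¬l)) k>

  f : Vec ℕ n → Fin k
  f s = fromℕ< (colour-< s)

  f-colour : ∀ (s : Vec ℕ n) → toℕ (f s) ≡ colour (enc s)
  f-colour s = F.toℕ-fromℕ< (colour-< s)

  f-computable : ComputableColoring f
  f-computable = graphF (proj₁ comp-colour) n , graphF-Σ₁ (proj₁ comp-colour) n , λ s _ c →
    subst (λ x → Sat (graphF (proj₁ comp-colour) n) (c ∷ s) ⇔ (x ≡ c)) (sym (f-colour s)) (graphF-correct comp-colour s c)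

  -- Packed sets take too many colours

  module _ (ψ : Formula 1) (σψ : IsΣ n ψ) (packed : Packed φ (Defined ψ)) where

    A : ℕ → Set
    A = Defined ψ

    -- Up to `w` there are `n * h w` elements in `suc (h w)` blocks. Discarding the first `X` leads
    -- beyond block `N`, and since `q < n` and `h w` exceeds `X + q`, more than `q` elements per
    -- block remain on average.
    run : ∀ q → q < n → ∀ N → ∃ λ j → N ≤ j × Σ (Vec ℕ (suc q)) λ v → Increasing v × All (λ y → A y × h y ≡ j) v
    run q q<n N with h-reach N
    ... | X , reach with h-reach (suc (X + q))
    ... | W , reachW with packed W
    ... | w , W≤w , v , iv , v∈ with drop-≥ X 0 (toList v) (linked⇒inc iv) (λ _ → z≤n)
    ... | l , incl , l⊆ , X≤ , len with find-run h q (suc (h w)) N l incl range long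
      where
      in-A : ∀ {y} → y ∈ˡ toList v → 1 ≤ y × y ≤ w × A y
      in-A i = All.lookup v∈ (∈-toList⁻ i)
      range : ∀ {y} → y ∈ˡ l → N ≤ h y × h y < N + suc (h w)
      range i = reach (X≤ i) , ≤-trans (s≤s (h-mono (proj₁ (proj₂ (in-A (l⊆ i)))))) (m≤n+m (suc (h w)) N)
      long : q * suc (h w) < length l
      long = +-cancelˡ-< X _ _ (begin-strict
        X + q * suc (h w)       ≡⟨ cong (X +_) (*-suc q (h w)) ⟩
        X + (q + q * h w)       ≡⟨ sym (+-assoc X q (q * h w)) ⟩
        X + q + q * h w         <⟨ +-monoˡ-< (q * h w) (reachW W≤w) ⟩
        suc q * h w             ≤⟨ *-monoˡ-≤ (h w) q<n ⟩
        n * h w                 ≡⟨ sym (length-toList v) ⟩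
        length (toList v)       ≤⟨ len ⟩
        X + length l            ∎)
        where open ≤-Reasoning
    ... | j , N≤j , u , iu , u∈ = j , N≤j , u , iu ,
      All.map (λ (i , e) → proj₂ (proj₂ (All.lookup v∈ (∈-toList⁻ (l⊆ i)))) , e) u∈

    unbounded : ∀ N → ∃ λ x → A x × N ≤ h x
    unbounded N with run 0 (s≤s z≤n) N
    ... | j , N≤j , x ∷ [] , _ , (x∈ , refl) ∷ [] = x , x∈ , N≤j

    -- The digits of `t` are followed from the lowest: 1 takes the next element of the current
    -- block, 0 moves on to a run in a later block. The `p` spare elements in `v` suffice for `p`
    -- digits.
    realize : ∀ p → p < n → ∀ t → t < 2 ^ p → ∀ {j} x (v : Vec ℕ p) → Increasing (x ∷ v) →
      All (λ y → A y × h y ≡ j) (x ∷ v) →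
      Σ (Vec ℕ p) λ s → Increasing (x ∷ s) × All A (x ∷ s) × joins p (x ∷ s) ≡ t
    realize zero    p< zero t< x v iv ((x∈ , _) ∷ _) = [] , [-] , x∈ ∷ [] , refl
    realize zero    p< (suc t) (s≤s ()) x v iv x∈
    realize (suc p) p< t t< x (y ∷ v) (x<y ∷ iv) ((x∈ , x≡) ∷ ys∈@((_ , y≡) ∷ _)) with halve t
    ... | _ , t′ , refl , inj₂ refl with realize p (<⇒≤ p<) t′ (*-cancelˡ-< 2 t′ (2 ^ p) (<⇒≤ t<)) y v iv ys∈
    ... | s , is , s∈ , eq = y ∷ s , x<y ∷ is , x∈ ∷ s∈ , cong₂ _+_ (same-≡ {x} {y} (trans x≡ (sym y≡))) (cong (2 *_) eq)
    realize (suc p) p< t t< {j} x (y ∷ v) _ ((x∈ , x≡) ∷ _) | _ , t′ , refl , inj₁ refl with run p (<⇒≤ p<) (suc j)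
    ... | j′ , j<j′ , z ∷ u , iu , zu∈@((_ , z≡) ∷ _) with realize p (<⇒≤ p<) t′ (*-cancelˡ-< 2 t′ (2 ^ p) t<) z u iu zu∈
    ... | s , is , s∈ , eq = z ∷ s , ≰⇒> (λ le → <⇒≱ x<z (h-mono le)) ∷ is , x∈ ∷ s∈ ,
          cong₂ _+_ (same-< {x} {z} x<z) (cong (2 *_) eq)
      where
      x<z : h x < h z
      x<z = subst₂ _<_ (sym x≡) (sym z≡) j<j′

    open Avoidance m h h-mono A unbounded

    chain-increasing : ∀ p x (ys : Vec ℕ p) → A x → Chain p x ys → Increasing (x ∷ ys) × All A (x ∷ ys) × joins p (x ∷ ys) ≡ 0
    chain-increasing zero    x []       x∈ _             = [-] , x∈ ∷ [] , refl
    chain-increasing (suc p) x (y ∷ ys) x∈ (lt , y∈ , c) with chain-increasing p y ys y∈ c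
    ... | i , ys∈ , eq = h-cancel lt ∷ i , x∈ ∷ ys∈ , cong₂ _+_ (same-< {x} {y} lt) (cong (2 *_) eq)

    index : ∃ λ e → (∀ x → A x → ∃ λ a → L (suc m) e (pair x a)) × (Markov m → ∀ x a → L (suc m) e (pair x a) → A x)
    -- The block variable starts as a dummy, as only `π₁ u` enters; hence the witness 0 below.
    index with Σ-block σψ {λ u → π₁ u ∷ []} (compV-∷ (comp-π₁ comp-id) compV-[])
    ... | e , r = e ,
      (λ x x∈ → proj₁ (r x) (0 , subst A (sym (π₁-pair x 0)) x∈)) ,
      (λ mk x a l → let b , s = proj₂ (r x) mk (a , l) in subst A (π₁-pair x b) s)

    -- Colour 0 comes from `¬never` and the last colour from `¬always`; each colour in between is a
    -- pattern with a coincidence, supplied by `realize`.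
    every-colour : ∀ c → c ≤ 2 ^ suc m → ¬ (∀ (s : Vec ℕ n) → Increasing s → All A s → colour (enc s) ≢ c)
    every-colour zero _ avoid = ¬never (proj₁ (proj₂ index)) (proj₂ (proj₂ index)) λ x ys x∈ c l →
      let i , s∈ , j≡0 = chain-increasing (suc m) x ys x∈ c in avoid (x ∷ ys) i s∈ (colour-low x ys j≡0 l)
    every-colour c@(suc _) c≤ avoid with m≤n⇒m<n∨m≡n c≤
    ... | inj₂ c≡ = ¬always (proj₁ (proj₂ index)) (proj₂ (proj₂ index)) λ x ys x∈ ch →
      let i , s∈ , j≡0 = chain-increasing (suc m) x ys x∈ ch in case low? x ys of λ where
        (yes l) → l
        (no ¬l) → contradiction (trans (colour-high x ys j≡0 ¬l) (sym c≡)) (avoid (x ∷ ys) i s∈)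
    ... | inj₁ c< with run (suc m) ≤-refl 0
    ... | j , _ , x ∷ v , iv , v∈ with realize (suc m) ≤-refl c c< x v iv v∈
    ... | s , is , s∈ , eq = avoid (x ∷ s) is s∈
      (trans (colour-joined (x ∷ s) (λ e → case trans (sym eq) e of λ ())) eq)

    -- The colours from 0 to `2 ^ suc m` are one more than `C` can list. Membership in `C` is
    -- decidable, so the negative form of `every-colour` suffices.
    ¬semi-homogeneous : ¬ SemiHomogeneous f A
    ¬semi-homogeneous (C , f∈) = too-many-colours C c c-injective λ i → decidable-stable (AnyV.any? (c i F.≟_) C)
      λ c∉ → every-colour (toℕ i) (≤-pred (F.toℕ<n i)) λ s is s∈ eq →
        c∉ (subst (_∈ C) (F.toℕ-injective (trans (f-colour s) (trans eq (sym (c-value i))))) (f∈ s is s∈))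
      where
      i<k : ∀ (i : Fin (suc (2 ^ suc m))) → toℕ i < k
      i<k i = ≤-<-trans (≤-pred (F.toℕ<n i)) k>
      c : Fin (suc (2 ^ suc m)) → Fin k
      c i = fromℕ< (i<k i)
      c-value : ∀ i → toℕ (c i) ≡ toℕ i
      c-value i = F.toℕ-fromℕ< (i<k i)
      c-injective : ∀ i j → c i ≡ c j → i ≡ j
      c-injective i j eq = F.toℕ-injective (trans (sym (c-value i)) (trans (cong toℕ eq) (c-value j)))

theorem6p7 : (n k : ℕ) → 2 ≤ n → 2 ^ (n ∸ 1) < k →
    Σ (Vec ℕ n → Fin k) λ f → Σ (ℕ → ℕ) λ φ →
    ComputableColoring f × ComputableFun φ ×
    ((w : ℕ) → Arrow w (φ w) n (suc k)) × LiminfInfinite φ ×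
    ((ψ : Formula 1) → IsΣ n ψ →
    ¬ (Packed φ (Defined ψ) × SemiHomogeneous f (Defined ψ)))
theorem6p7 (suc (suc m)) k (s≤s (s≤s _)) k> =
  f , φ , f-computable , φ-computable , φ-arrow , φ-liminf , λ ψ σψ (packed , semi) → ¬semi-homogeneous ψ σψ packed semi
  where
  n : ℕ
  n = suc (suc m)
  R : ℕ → ℕ
  -- `n * j` is the size that `φ` demands in block `j`.
  R j = ramsey (suc k) n (n * j)
  open Blocks R
  open Construction m k k> (block R) block-mono block-reach
    (comp-block λ cu → comp-ramsey (suc k) n (comp-* (comp-const n) cu)) hiding (n)
  φ-arrow : ∀ w → Arrow w (φ w) n (suc k)
  φ-arrow w with block-bound w
  ... | inj₂ le = arrow k n (φ w) w le
  -- In block 0 the homogeneous set is empty; it contains no n-set because `n` is positive, so any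
  -- colour serves.
  ... | inj₁ eq = subst (λ j → Arrow w (n * j) n (suc k)) (sym eq)
    (subst (λ j → Arrow w j n (suc k)) (sym (*-zeroʳ n)) λ X inc g → [] , [] , [] , F.zero , λ { (_ ∷ _) _ (() ∷ _) })
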